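{- Let $G$ be a finite simple graph that contains no theta, no wheel and no pyramid as an induced subgraph. Then $G$ is the line graph of a triangle-free chordless graph, or $G$ admits a clique cutset.
   Context: A hole is a chordless cycle of length at least 4. A prism consists of three node-disjoint chordless paths $a_1\dots b_1$, $a_2\dots b_2$, $a_3\dots b_3$, each of length at least 1, such that $a_1a_2a_3$ and $b_1b_2b_3$ are triangles and there are no edges between the paths other than those of the two triangles. A pyramid consists of three chordless paths $a\dots b_1$, $a\dots b_2$, $a\dots b_3$ of length at least 1, at least two of length at least 2, pairwise node-disjoint except at $a$, such that $b_1b_2b_3$ is a triangle and there are no edges between the paths other than those of the triangle and the three edges incident to $a$. A theta consists of three internally node-disjoint chordless paths between two nodes $a,b$, each of length at least 2, with no edges between the paths other than the three edges at $a$ and the three edges at $b$. A wheel is a hole $H$ together with a node $c\notin V(H)$ having at least three neighbors in $H$. "Contains" means "has an induced subgraph isomorphic to". A graph is chordless if every cycle of it is chordless (has no chord). A clique cutset is a set $S$ of nodes inducing a clique (possibly empty) such that $G\setminus S$ is disconnected; in particular a disconnected graph has a clique cutset. The line graph $L(R)$ of $R$ has the edges of $R$ as nodes, two being adjacent when they share an end. -}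

module Defs where

open import Data.Nat using (ℕ; zero; suc; _≤_; _<_)
open import Data.Fin using (Fin; toℕ; fromℕ; _≟_)
open import Data.Bool using (Bool; true; false; T)
open import Data.Product using (Σ; ∃; ∃-syntax; _×_; _,_)
open import Data.Sum using (_⊎_)
open import Relation.Nullary using (¬_)
open import Relation.Binary.PropositionalEquality using (_≡_; _≢_)
open import Function.Bundles using (_⇔_)
open import Data.Fin.Subset using (Subset; _∈_; _∉_)

record Graph (n : ℕ) : Set where
  field
    adj   : Fin n → Fin n → Bool
    sym   : ∀ i j → adj i j ≡ adj j i
    loopless : ∀ i → adj i i ≡ false

open Graph public

module _ {n : ℕ} (G : Graph n) where

  Adj : Fin n → Fin n → Set
  Adj i j = T (adj G i j)

  record ChordlessPath : Set where
    field
      len  : ℕ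
      vert : Fin (suc len) → Fin n
      inj  : ∀ i j → vert i ≡ vert j → i ≡ j
      induced : ∀ i j →
        Adj (vert i) (vert j) ⇔ (suc (toℕ i) ≡ toℕ j ⊎ suc (toℕ j) ≡ toℕ i)

    first : Fin n
    first = vert Fin.zero

    last : Fin n
    last = vert (fromℕ len)

  open ChordlessPath public

  Interior : (P : ChordlessPath) → Fin (suc (len P)) → Set
  Interior P i = 0 < toℕ i × toℕ i < len P

  CycConsec : (k : ℕ) → Fin k → Fin k → Set
  CycConsec k i j =
      suc (toℕ i) ≡ toℕ j
    ⊎ suc (toℕ j) ≡ toℕ i
    ⊎ (toℕ i ≡ 0 × suc (toℕ j) ≡ k)
    ⊎ (toℕ j ≡ 0 × suc (toℕ i) ≡ k)

  record Hole : Set where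
    field
      size : ℕ
      size≥4 : 4 ≤ size
      hv   : Fin size → Fin n
      hinj : ∀ i j → hv i ≡ hv j → i ≡ j
      hinduced : ∀ i j → Adj (hv i) (hv j) ⇔ CycConsec size i j

  open Hole public

  ContainsTheta : Set
  ContainsTheta =
    Σ (Fin n) λ a → Σ (Fin n) λ b →
    Σ (Fin 3 → ChordlessPath) λ P →
      (∀ x → first (P x) ≡ a × last (P x) ≡ b × 2 ≤ len (P x))
    × (∀ x y → x ≢ y →
         ∀ i j → Interior (P x) i → Interior (P y) j →
           vert (P x) i ≢ vert (P y) j × ¬ Adj (vert (P x) i) (vert (P y) j))

  -- G contains a pyramid (as an induced subgraph): paths a…b_x,
  -- b_1 b_2 b_3 a triangle.  The only edges between distinct paths are
  -- those between their last vertices b_x (which must all be present).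
  ContainsPyramid : Set
  ContainsPyramid =
    Σ (Fin n) λ a →
    Σ (Fin 3 → ChordlessPath) λ P →
      (∀ x → first (P x) ≡ a × 1 ≤ len (P x))
    × (Σ (Fin 3) λ x → Σ (Fin 3) λ y → x ≢ y × 2 ≤ len (P x) × 2 ≤ len (P y))
    × (∀ x y → x ≢ y →
         ∀ i j → 0 < toℕ i → 0 < toℕ j →
           vert (P x) i ≢ vert (P y) j
         × (Adj (vert (P x) i) (vert (P y) j)
              ⇔ (toℕ i ≡ len (P x) × toℕ j ≡ len (P y))))

  ContainsWheel : Set
  ContainsWheel =
    Σ Hole λ H → Σ (Fin n) λ c →
      (∀ i → hv H i ≢ c)
    × (Σ (Fin (size H)) λ i₁ → Σ (Fin (size H)) λ i₂ → Σ (Fin (size H)) λ i₃ →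
         i₁ ≢ i₂ × i₁ ≢ i₃ × i₂ ≢ i₃
       × Adj c (hv H i₁) × Adj c (hv H i₂) × Adj c (hv H i₃))

  record Cycle : Set where
    field
      clen : ℕ
      clen≥3 : 3 ≤ clen
      cv   : Fin clen → Fin n
      cinj : ∀ i j → cv i ≡ cv j → i ≡ j
      cedges : ∀ i j → CycConsec clen i j → Adj (cv i) (cv j)

  open Cycle public

  Chordless : Set
  Chordless = ∀ (C : Cycle) → ∀ i j → Adj (cv C i) (cv C j) → CycConsec (clen C) i j

  TriangleFree : Set
  TriangleFree = ∀ u v w → Adj u v → Adj v w → Adj u w → Data.Empty.⊥
    where import Data.Empty

  data ReachOutside (S : Subset n) : Fin n → Fin n → Set where
    here : ∀ {u} → u ∉ S → ReachOutside S u u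
    step : ∀ {u v w} → u ∉ S → Adj u v → ReachOutside S v w → ReachOutside S u w

  IsClique : Subset n → Set
  IsClique S = ∀ u v → u ∈ S → v ∈ S → u ≢ v → Adj u v

  -- S is a clique cutset: S is a clique (possibly empty) and G ∖ S is
  -- disconnected (has two nodes not joined by a path in G ∖ S).
  HasCliqueCutset : Set
  HasCliqueCutset =
    Σ (Subset n) λ S → IsClique S ×
      Σ (Fin n) λ u → Σ (Fin n) λ v → u ∉ S × v ∉ S × ¬ ReachOutside S u v

IsLineGraphOf : ∀ {n m} → Graph n → Graph m → Set
IsLineGraphOf {n} {m} G R =
  Σ (Fin n → Fin m × Fin m) λ e →
    (∀ i → let (p , q) = e i in toℕ p < toℕ q × Adj R p q)
  × (∀ i j → e i ≡ e j → i ≡ j)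
  × (∀ p q → toℕ p < toℕ q → Adj R p q → Σ (Fin n) λ i → e i ≡ (p , q))
  × (∀ i j → Adj G i j ⇔ (i ≢ j × ShareEnd (e i) (e j)))
  where
  ShareEnd : Fin m × Fin m → Fin m × Fin m → Set
  ShareEnd (p , q) (p' , q') = p ≡ p' ⊎ p ≡ q' ⊎ q ≡ p' ⊎ q ≡ q'

{-# OPTIONS --safe #-}
module Submission where

open import Defs hiding (sym)
open import Data.Bool using (Bool; true; false; not; T; T?)
open import Data.Bool.Properties using (not-involutive)
open import Data.Empty using (⊥; ⊥-elim)
open import Data.Fin using (Fin; zero; suc; toℕ; fromℕ; inject₁; combine; _≟_)
open import Data.Fin.Properties using (all?; combine-injective; fromℕ≢inject₁; inject₁-injective; suc-injective; toℕ-fromℕ; toℕ-inject₁; toℕ-injective) renaming (any? to ∃?)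
open import Data.Fin.Relation.Unary.Top using (view; ‵fromℕ; ‵inject₁)
open import Data.Fin.Subset using (Subset; ⁅_⁆; _∪_) renaming (_∈_ to _∈ₛ_; _∉_ to _∉ₛ_; _⊆_ to _⊆ₛ_; _⊃_ to _⊃ₛ_)
open import Data.Fin.Subset.Induction using (⊃-wellFounded; Acc; acc)
open import Data.Fin.Subset.Properties using (_∈?_; anySubset?; p⊆p∪q; x∈p∪q⁺; x∈p∪q⁻; x∈⁅x⁆; x∈⁅y⁆⇒x≡y; ⊆-antisym)
open import Data.List using (List; []; _∷_; _++_; [_]; length; lookup; reverse)
import Data.List.Properties as Listₚ
open import Data.List.Membership.Propositional using (_∈_; find)
open import Data.List.Relation.Unary.All as All using (All; []; _∷_)
open import Data.List.Relation.Unary.All.Properties as Allₚ using (¬Any⇒All¬; All¬⇒¬Any)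
open import Data.List.Relation.Unary.Any as Any using (Any; here; there; any?)
open import Data.List.Relation.Unary.Any.Properties as Anyₚ using (lookup-index)
open import Data.Nat as ℕ using (ℕ; zero; suc; _^_; _≤_; _<_; s≤s; z≤n)
import Data.Nat.Properties as ℕₚ
open import Data.Product using (Σ; ∃; _×_; _,_; proj₁; proj₂; swap)
open import Data.Sum using (_⊎_; inj₁; inj₂)
open import Data.Unit using (⊤; tt)
open import Data.Vec using ([]; _∷_; here; there; tabulate)
import Data.Vec.Properties as Vecₚ
open import Function using (_∘_; _⇔_; mk⇔; Equivalence)
open import Relation.Binary using (tri<; tri≈; tri>)
open import Relation.Binary.PropositionalEquality using (_≡_; _≢_; refl; sym; trans; cong; cong₂; subst)
open import Relation.Nullary using (¬_; Dec; yes; no; contradiction; does)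
open import Relation.Nullary.Decidable using (¬?; _×-dec_; _⊎-dec_; _→-dec_; dec-true; decidable-stable; fromWitness; isYes; toWitness)
open import Relation.Unary using (Decidable)

-- Suppose that G has no clique cutset.
--
-- Diamonds: take a largest clique K with at least two nodes that is complete to two nonadjacent
-- nodes c and d.  On a path c, p, p₂, …, d avoiding K, the node p is complete to K, since otherwise
-- there is a wheel, and then so is p₂; hence K ∪ {p} and c, p₂ contradict the choice of K.
--
-- Claws: without diamonds, N(a) is a disjoint union of cliques.  If a is the center of a claw, there
-- is a hole through a and two of its neighbours b and y in different cliques, whose remaining nodes
-- lie in one component D of G ∖ N[a].  A third clique attached to D would give a theta or a pyramid.
-- As {a} together with the clique of b (or of y) is no cutset, b and y are joined by a path avoiding
-- a and D, and the two paths from b to y form with a a theta or a wheel.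
--
-- A graph without claws and diamonds is the line graph of a triangle-free graph, whose nodes are its
-- maximal cliques and some nodes of degree one; a cycle with a chord in it gives a wheel.

-- The conclusion is a disjunction, so the existence of a clique cutset is decided by finite search;
-- reachability is decidable as well, which turns the absence of cutsets into actual walks. Induced
-- paths are lists in which every node is `Far` from all later ones but the next, so that cutting
-- and joining are statements about `++`; indexed paths and holes appear only when a forbidden
-- subgraph is produced. The delicate point of the claw argument is a path from `b` to `y` outside D
-- ∪ {a}. Let `d` be a neighbour of `a` in a third clique. Deleting `a` and the clique of `y` leaves
-- a walk from `d` to `b`. It can enter D only from a neighbour of `a` attached to D; such a
-- neighbour lies in the clique of `b`, and from there the walk turns to `b` at once. Exchanging `b`
-- and `y` gives a second walk from `d`, and the two are put together. The result may still meet
-- N(a), whence the alternative between a theta and a wheel at the end.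

module _ {m} {P : Fin m → Set} (P? : Decidable P) where

  comprehension : Subset m
  comprehension = tabulate (does ∘ P?)

  ∈-comprehension⁺ : ∀ {x} → P x → x ∈ₛ comprehension
  ∈-comprehension⁺ {x} p = Vecₚ.lookup⇒[]= x _ (trans (Vecₚ.lookup∘tabulate _ x) (dec-true (P? x) p))

  ∈-comprehension⁻ : ∀ {x} → x ∈ₛ comprehension → P x
  ∈-comprehension⁻ {x} x∈ with P? x | trans (sym (Vecₚ.lookup∘tabulate (does ∘ P?) x)) (Vecₚ.[]=⇒lookup x∈)
  ... | yes p | _ = p
  ... | no _  | ()

bit : Bool → Fin 2
bit false = zero
bit true  = suc zero

bit-injective : ∀ {x y} → bit x ≡ bit y → x ≡ y
bit-injective {false} {false} _ = refl
bit-injective {true}  {true}  _ = refl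

-- Cliques of one graph are to be the nodes of another, whose node set must be some `Fin m`; only
-- injectivity of the numbering matters.
encode : ∀ {m} → Subset m → Fin (2 ^ m)
encode []      = zero
encode (x ∷ s) = combine (bit x) (encode s)

encode-injective : ∀ {m} {s t : Subset m} → encode s ≡ encode t → s ≡ t
encode-injective {s = []}    {[]}    _  = refl
encode-injective {s = x ∷ s} {y ∷ t} eq with combine-injective (bit x) (encode s) (bit y) (encode t) eq
... | x≡y , s≡t = cong₂ _∷_ (bit-injective x≡y) (encode-injective s≡t)

isYes-⇔ : {P Q : Set} → (P → Q) → (Q → P) → (p : Dec P) (q : Dec Q) → isYes p ≡ isYes q
isYes-⇔ f g (yes _) (yes _) = refl
isYes-⇔ f g (yes p) (no ¬q) = contradiction (f p) ¬q
isYes-⇔ f g (no ¬p) (yes q) = contradiction (g q) ¬p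
isYes-⇔ f g (no _)  (no _)  = refl

isYes-no : {P : Set} → ¬ P → (p : Dec P) → isYes p ≡ false
isYes-no ¬p (yes p) = contradiction p ¬p
isYes-no ¬p (no _)  = refl

module _ {A : Set} {P : A → Set} where

  all-reverse : ∀ {xs} → All P xs → All P (reverse xs)
  all-reverse []                  = []
  all-reverse {x ∷ xs} (p ∷ ps) =
    subst (All P) (sym (Listₚ.unfold-reverse x xs)) (Allₚ.++⁺ (all-reverse ps) (p ∷ []))

  data FirstHit : List A → Set where
    first-hit : ∀ {l x r} → All (¬_ ∘ P) l → P x → FirstHit (l ++ x ∷ r)

  data LastHit : List A → Set where
    last-hit : ∀ {l x r} → P x → All (¬_ ∘ P) r → LastHit (l ++ x ∷ r)

  firstHit : Decidable P → ∀ {xs} → Any P xs → FirstHit xs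
  firstHit P? {x ∷ xs} any with P? x
  firstHit P? {x ∷ xs} any        | yes p = first-hit [] p
  firstHit P? {x ∷ xs} (here p)   | no ¬p = contradiction p ¬p
  firstHit P? {x ∷ xs} (there ps) | no ¬p with firstHit P? ps
  ... | first-hit ¬ps q = first-hit (¬p ∷ ¬ps) q

  lastHit : Decidable P → ∀ {xs} → Any P xs → LastHit xs
  lastHit P? {x ∷ xs} any with any? P? xs
  lastHit P? {x ∷ xs} any        | yes ps with lastHit P? ps
  ... | last-hit {l} q ¬ps = last-hit {l = x ∷ l} q ¬ps
  lastHit P? {x ∷ xs} (here p)   | no ¬ps = last-hit {l = []} p (¬Any⇒All¬ xs ¬ps)
  lastHit P? {x ∷ xs} (there ps) | no ¬ps = contradiction ps ¬ps

module _ {n : ℕ} (G : Graph n) where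

  -- Adjacency, induced paths and walks

  V : Set
  V = Fin n

  infix 4 _~_ _~?_

  _~_ : V → V → Set
  _~_ = Adj G

  _~?_ : ∀ u v → Dec (u ~ v)
  u ~? v = T? (adj G u v)

  ~-sym : ∀ {u v} → u ~ v → v ~ u
  ~-sym {u} {v} = subst T (Graph.sym G u v)

  ~-irrefl : ∀ {u} → ¬ u ~ u
  ~-irrefl {u} = subst T (loopless G u)

  ~⇒≢ : ∀ {u v} → u ~ v → u ≢ v
  ~⇒≢ uv refl = ~-irrefl uv

  Far : V → V → Set
  Far u v = u ≢ v × ¬ u ~ v

  far-sym : ∀ {u v} → Far u v → Far v u
  far-sym (u≢v , u≁v) = u≢v ∘ sym , u≁v ∘ ~-sym

  far? : ∀ u v → Dec (Far u v)
  far? u v = ¬? (u ≟ v) ×-dec ¬? (u ~? v)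

  ¬far : ∀ {u v} → ¬ Far u v → u ≡ v ⊎ u ~ v
  ¬far {u} {v} ¬f with u ≟ v | u ~? v
  ... | yes u≡v | _       = inj₁ u≡v
  ... | no _    | yes u~v = inj₂ u~v
  ... | no u≢v  | no u≁v  = contradiction (u≢v , u≁v) ¬f

  far-from : ∀ {u v w} → v ~ u → Far v w → w ≢ u
  far-from v~u (_ , v≁w) refl = v≁w v~u

  Apart : List V → List V → Set
  Apart xs ys = All (λ x → All (Far x) ys) xs

  apart-sym : ∀ {xs ys} → Apart xs ys → Apart ys xs
  apart-sym {ys = []}     _ = []
  apart-sym {ys = y ∷ ys} a = All.map (far-sym ∘ All.head) a ∷ apart-sym (All.map All.tail a)

  -- The last node of a path is where a hole closes, where another path is joined or where the
  -- triangle of a pyramid sits; such conditions single out this node alone.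
  data Until (P Q : V → Set) : List V → Set where
    end : ∀ {x} → Q x → Until P Q (x ∷ [])
    _∷_ : ∀ {x xs} → P x → Until P Q xs → Until P Q (x ∷ xs)

  module _ {P Q : V → Set} where

    until-++ : ∀ {xs ys} → All P xs → Until P Q ys → Until P Q (xs ++ ys)
    until-++ []       u = u
    until-++ (p ∷ ps) u = p ∷ until-++ ps u

    until-init : ∀ xs {y ys} → Until P Q (xs ++ y ∷ ys) → All P xs
    until-init []           _       = []
    until-init (x ∷ [])     (p ∷ _) = p ∷ []
    until-init (x ∷ z ∷ xs) (p ∷ u) = p ∷ until-init (z ∷ xs) u

    data Snoc : List V → Set where
      snoc : ∀ {xs x} → All P xs → Q x → Snoc (xs ++ x ∷ [])

    until-snoc : ∀ {xs} → Until P Q xs → Snoc xs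
    until-snoc (end q) = snoc [] q
    until-snoc (p ∷ u) with until-snoc u
    ... | snoc ps q = snoc (p ∷ ps) q

  until-map : ∀ {P Q P′ Q′ : V → Set} → (∀ {x} → P x → P′ x) → (∀ {x} → Q x → Q′ x) →
              ∀ {xs} → Until P Q xs → Until P′ Q′ xs
  until-map f g (end q) = end (g q)
  until-map f g (p ∷ u) = f p ∷ until-map f g u

  data IsPath : List V → Set where
    single : ∀ {x} → IsPath (x ∷ [])
    cons   : ∀ {x y ys} → x ~ y → All (Far x) ys → IsPath (y ∷ ys) → IsPath (x ∷ y ∷ ys)

  path-++ʳ : ∀ xs {y ys} → IsPath (xs ++ y ∷ ys) → IsPath (y ∷ ys)
  path-++ʳ []           p            = p
  path-++ʳ (x ∷ [])     (cons _ _ p) = p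
  path-++ʳ (x ∷ z ∷ xs) (cons _ _ p) = path-++ʳ (z ∷ xs) p

  path-++ˡ : ∀ x xs {ys} → IsPath (x ∷ xs ++ ys) → IsPath (x ∷ xs)
  path-++ˡ x []       p            = single
  path-++ˡ x (y ∷ xs) (cons a f p) = cons a (Allₚ.++⁻ˡ xs f) (path-++ˡ y xs p)

  path-prefix : ∀ xs {y ys} → IsPath (xs ++ y ∷ ys) → IsPath (xs ++ [ y ])
  path-prefix xs {y} {ys} p = lemma xs (subst IsPath (sym (Listₚ.++-assoc xs [ y ] ys)) p)
    where
    lemma : ∀ xs {ys} → IsPath ((xs ++ [ y ]) ++ ys) → IsPath (xs ++ [ y ])
    lemma []       = path-++ˡ y []
    lemma (x ∷ xs) = path-++ˡ x (xs ++ [ y ])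

  path-join : ∀ {xs y ys} → IsPath xs → IsPath (y ∷ ys) →
              Until (λ x → All (Far x) (y ∷ ys)) (λ x → x ~ y × All (Far x) ys) xs →
              IsPath (xs ++ y ∷ ys)
  path-join single       q (end (a , f)) = cons a f q
  path-join (cons a f p) q (g ∷ u)       = cons a (Allₚ.++⁺ f g) (path-join p q u)

  path-∷ʳ : ∀ {xs y} → IsPath xs → Until (λ x → Far x y) (_~ y) xs → IsPath (xs ++ [ y ])
  path-∷ʳ p u = path-join p single (until-map (_∷ []) (_, []) u)

  path-sep : ∀ xs {y ys} → IsPath (xs ++ y ∷ ys) → Apart xs ys
  path-sep []           _            = []
  path-sep (x ∷ [])     (cons _ f _) = f ∷ []
  path-sep (x ∷ z ∷ xs) (cons _ f p) =
    All.tail (Allₚ.++⁻ʳ xs f) ∷ path-sep (z ∷ xs) p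

  path-last : ∀ x xs {y ys} → IsPath (x ∷ xs ++ y ∷ ys) →
              Until (λ x → Far x y) (_~ y) (x ∷ xs)
  path-last x []       (cons a _ _) = end a
  path-last x (z ∷ xs) (cons _ f p) = All.head (Allₚ.++⁻ʳ xs f) ∷ path-last z xs p

  path-reverse : ∀ {xs} → IsPath xs → IsPath (reverse xs)
  path-reverse single = single
  path-reverse {x ∷ y ∷ ys} (cons a f p) =
    subst IsPath (sym (Listₚ.unfold-reverse x (y ∷ ys))) (path-∷ʳ (path-reverse p)
      (subst (Until _ _) (sym (Listₚ.unfold-reverse y ys))
        (until-++ (all-reverse (All.map far-sym f)) (end (~-sym a)))))

  path-∉ : ∀ {x xs} → IsPath (x ∷ xs) → All (x ≢_) xs
  path-∉ single       = []
  path-∉ (cons a f _) = ~⇒≢ a ∷ All.map proj₁ f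

  data Walk (P Q : V → Set) (u : V) : Set where
    stop : Q u → Walk P Q u
    step : ∀ {v} → P u → u ~ v → Walk P Q v → Walk P Q u

  -- Everything before the last node equal or adjacent to `x` is dropped. Equality means that `x` is
  -- already on the path; adjacency makes `x` a new first node, far from all but the second. The end
  -- of the path survives, and with it `Q`.
  extend-path : ∀ {P Q x y ys} → P x → IsPath (y ∷ ys) → Until P Q (y ∷ ys) →
                Any (¬_ ∘ Far x) (y ∷ ys) → ∃ λ zs → IsPath (x ∷ zs) × Until P Q (x ∷ zs)
  extend-path {x = x} {y} {ys} px path u any with any? (¬? ∘ far? x) ys
  extend-path {ys = _ ∷ _} px (cons _ _ path) (_ ∷ u) any | yes any′ = extend-path px path u any′
  extend-path px path u (there any) | no none = contradiction any none
  extend-path {x = x} px path u (here ¬f) | no none with ¬far ¬f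
  ... | inj₁ refl = _ , path , u
  ... | inj₂ x~y  = _ , cons x~y far path , px ∷ u
    where
    far : All (Far x) _
    far = All.map (λ {z} → decidable-stable (far? x z)) (¬Any⇒All¬ _ none)

  route : ∀ {P Q u} → Walk P Q u → ∃ λ xs → IsPath (u ∷ xs) × Until P Q (u ∷ xs)
  route (stop q) = [] , single , end q
  route (step p a w) with route w
  ... | _ , path , u = extend-path p path u (here λ f → proj₂ f a)

  -- Cyclic successions

  prev : ∀ {k} → Fin k → Fin k
  prev zero    = fromℕ _
  prev (suc i) = inject₁ i

  prev-injective : ∀ {k} {i j : Fin k} → prev i ≡ prev j → i ≡ j
  prev-injective {i = zero}  {zero}  _  = refl
  prev-injective {i = zero}  {suc j} eq = contradiction eq fromℕ≢inject₁
  prev-injective {i = suc i} {zero}  eq = contradiction (sym eq) fromℕ≢inject₁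
  prev-injective {i = suc i} {suc j} eq = cong suc (inject₁-injective eq)

  prev-surjective : ∀ {k} (i : Fin k) → ∃ λ j → prev j ≡ i
  prev-surjective {suc k} i with view i
  ... | ‵fromℕ     = zero , refl
  ... | ‵inject₁ j = suc j , refl

  prev-prev : ∀ {k} → 3 ≤ k → (i : Fin k) → prev (prev i) ≢ i
  prev-prev (s≤s (s≤s (s≤s _))) zero          ()
  prev-prev (s≤s (s≤s (s≤s _))) (suc zero)    ()
  prev-prev (s≤s (s≤s (s≤s _))) (suc (suc i)) eq = ℕₚ.m≢1+n+m (toℕ i) {1}
    (trans (sym (trans (toℕ-inject₁ (inject₁ i)) (toℕ-inject₁ i))) (cong toℕ eq))

  prev-consecutive : ∀ {k} (i : Fin k) → CycConsec G k (prev i) i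
  prev-consecutive zero    = inj₂ (inj₂ (inj₂ (refl , cong suc (toℕ-fromℕ _))))
  prev-consecutive (suc i) = inj₁ (cong suc (toℕ-inject₁ i))

  consecutive-sym : ∀ {k i j} → CycConsec G k i j → CycConsec G k j i
  consecutive-sym (inj₁ x)               = inj₂ (inj₁ x)
  consecutive-sym (inj₂ (inj₁ x))        = inj₁ x
  consecutive-sym (inj₂ (inj₂ (inj₁ x))) = inj₂ (inj₂ (inj₂ x))
  consecutive-sym (inj₂ (inj₂ (inj₂ x))) = inj₂ (inj₂ (inj₁ x))

  consecutive-prev : ∀ {k} (i j : Fin k) → CycConsec G k i j → prev j ≡ i ⊎ prev i ≡ j
  consecutive-prev i j = λ
    { (inj₁ eq)                      → inj₁ (next i j eq)
    ; (inj₂ (inj₁ eq))               → inj₂ (next j i eq)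
    ; (inj₂ (inj₂ (inj₁ (eq , eq′)))) → inj₂ (wrap j i eq eq′)
    ; (inj₂ (inj₂ (inj₂ (eq , eq′)))) → inj₁ (wrap i j eq eq′) }
    where
    next : ∀ {k} (i j : Fin k) → suc (toℕ i) ≡ toℕ j → prev j ≡ i
    next i (suc j) eq = toℕ-injective (trans (toℕ-inject₁ j) (sym (ℕₚ.suc-injective eq)))
    wrap : ∀ {k} (i j : Fin k) → toℕ j ≡ 0 → suc (toℕ i) ≡ k → prev j ≡ i
    wrap {suc k} i zero _ eq = toℕ-injective (trans (toℕ-fromℕ k) (sym (ℕₚ.suc-injective eq)))

  -- From lists to holes, wheels, thetas and pyramids

  lookup-all : ∀ {P : V → Set} {xs} → All P xs → ∀ i → P (lookup xs i)
  lookup-all (p ∷ ps) zero    = p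
  lookup-all (p ∷ ps) (suc i) = lookup-all ps i

  until-lookup-last : ∀ {P Q xs} → Until P Q xs → ∀ i → suc (toℕ i) ≡ length xs → Q (lookup xs i)
  until-lookup-last (end q)  zero    _  = q
  until-lookup-last (p ∷ u)  (suc i) eq = until-lookup-last u i (ℕₚ.suc-injective eq)
  until-lookup-last (p ∷ end _)   zero ()
  until-lookup-last (p ∷ (_ ∷ _)) zero ()

  until-lookup-init : ∀ {P Q xs} → Until P Q xs → ∀ i → suc (toℕ i) ≢ length xs → P (lookup xs i)
  until-lookup-init (end q) zero    ne = contradiction refl ne
  until-lookup-init (p ∷ u) zero    _  = p
  until-lookup-init (p ∷ u) (suc i) ne = until-lookup-init u i (ne ∘ cong suc)

  path-lookup-injective : ∀ {xs} → IsPath xs → ∀ i j → lookup xs i ≡ lookup xs j → i ≡ j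
  path-lookup-injective {_ ∷ _} p zero    zero    _  = refl
  path-lookup-injective {_ ∷ _} p zero    (suc j) eq = contradiction eq (lookup-all (path-∉ p) j)
  path-lookup-injective {_ ∷ _} p (suc i) zero    eq = contradiction (sym eq) (lookup-all (path-∉ p) i)
  path-lookup-injective (cons _ _ p) (suc i) (suc j) eq = cong suc (path-lookup-injective p i j eq)

  Consecutive : ∀ {k} → Fin k → Fin k → Set
  Consecutive i j = suc (toℕ i) ≡ toℕ j ⊎ suc (toℕ j) ≡ toℕ i

  consecutive-suc : ∀ {k} {i j : Fin k} → Consecutive i j → Consecutive (suc i) (suc j)
  consecutive-suc (inj₁ eq) = inj₁ (cong suc eq)
  consecutive-suc (inj₂ eq) = inj₂ (cong suc eq)

  consecutive-pred : ∀ {k} {i j : Fin k} → Consecutive (suc i) (suc j) → Consecutive i j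
  consecutive-pred (inj₁ eq) = inj₁ (ℕₚ.suc-injective eq)
  consecutive-pred (inj₂ eq) = inj₂ (ℕₚ.suc-injective eq)

  path-lookup-adj : ∀ {xs} → IsPath xs → ∀ i j → lookup xs i ~ lookup xs j → Consecutive i j
  path-lookup-adj {_ ∷ _} p zero zero a = contradiction a ~-irrefl
  path-lookup-adj (cons _ _ _) zero (suc zero) a = inj₁ refl
  path-lookup-adj (cons _ f _) zero (suc (suc j)) a = contradiction a (proj₂ (lookup-all f j))
  path-lookup-adj (cons _ _ _) (suc zero) zero a = inj₂ refl
  path-lookup-adj (cons _ f _) (suc (suc i)) zero a = contradiction (~-sym a) (proj₂ (lookup-all f i))
  path-lookup-adj (cons _ _ p) (suc i) (suc j) a = consecutive-suc (path-lookup-adj p i j a)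

  path-lookup-consecutive : ∀ {xs} → IsPath xs → ∀ i j → Consecutive i j → lookup xs i ~ lookup xs j
  path-lookup-consecutive single zero zero (inj₁ ())
  path-lookup-consecutive single zero zero (inj₂ ())
  path-lookup-consecutive (cons _ _ _) zero zero (inj₁ ())
  path-lookup-consecutive (cons _ _ _) zero zero (inj₂ ())
  path-lookup-consecutive (cons a _ _) zero (suc zero) c = a
  path-lookup-consecutive (cons a _ _) zero (suc (suc j)) (inj₁ ())
  path-lookup-consecutive (cons a _ _) zero (suc (suc j)) (inj₂ ())
  path-lookup-consecutive (cons a _ _) (suc zero) zero c = ~-sym a
  path-lookup-consecutive (cons a _ _) (suc (suc j)) zero (inj₁ ())
  path-lookup-consecutive (cons a _ _) (suc (suc j)) zero (inj₂ ())
  path-lookup-consecutive (cons _ _ p) (suc i) (suc j) c = path-lookup-consecutive p i j (consecutive-pred c)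

  chordlessPath : ∀ {x xs} → IsPath (x ∷ xs) → ChordlessPath G
  chordlessPath {x} {xs} p = record
    { len = length xs
    ; vert = lookup (x ∷ xs)
    ; inj = path-lookup-injective p
    ; induced = λ i j → mk⇔ (path-lookup-adj p i j) (path-lookup-consecutive p i j)
    }

  -- The hole formed by a and the path b ∷ ms ++ [ c ].
  record Link (a b c : V) (ms : List V) : Set where
    field
      a~b   : a ~ b
      a~c   : a ~ c
      b-c   : Far b c
      path  : IsPath (b ∷ ms ++ [ c ])
      apart : All (Far a) ms

    nonempty : ms ≢ []
    nonempty refl with path
    ... | cons b~c _ _ = proj₂ b-c b~c

    until : Until (Far a) (a ~_) (ms ++ [ c ])
    until = until-++ apart (end a~c)

    a∉ : All (a ≢_) (b ∷ ms ++ [ c ])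
    a∉ = ~⇒≢ a~b ∷ Allₚ.++⁺ (All.map proj₁ apart) (~⇒≢ a~c ∷ [])

  link-sym : ∀ {a b c ms} → Link a b c ms → Link a c b (reverse ms)
  link-sym {a} {b} {c} {ms} l = record
    { a~b = a~c ; a~c = a~b ; b-c = far-sym b-c
    ; path = subst IsPath
        (trans (Listₚ.unfold-reverse b (ms ++ [ c ])) (cong (_++ [ b ]) (Listₚ.reverse-++ ms [ c ])))
        (path-reverse path)
    ; apart = all-reverse apart }
    where open Link l

  ≢[]-reverse : ∀ {xs : List V} → xs ≢ [] → reverse xs ≢ []
  ≢[]-reverse {xs} ne eq = ne (trans (sym (Listₚ.reverse-involutive xs)) (cong reverse eq))

  -- As `l` stops before `c`, its only node seen by `a` is `b`.
  prefix-path : ∀ {a b c ms} → Link a b c ms → ∀ l r → l ++ r ≡ b ∷ ms ++ [ c ] →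
                l ≢ [] → r ≢ [] → IsPath (a ∷ l)
  prefix-path k []       r        eq l≢ r≢ = contradiction refl l≢
  prefix-path k (x ∷ l)  []       eq l≢ r≢ = contradiction refl r≢
  prefix-path k (x ∷ l)  (y ∷ r)  eq l≢ r≢ with refl , eq′ ← Listₚ.∷-injective eq =
    cons a~b (until-init l (subst (Until _ _) (sym eq′) until))
      (path-++ˡ _ l (subst (λ z → IsPath (_ ∷ z)) (sym eq′) path))
    where open Link k

  suffix-path : ∀ {a b c ms} → Link a b c ms → ∀ l r → l ++ r ≡ b ∷ ms ++ [ c ] →
                l ≢ [] → r ≢ [] → IsPath (a ∷ reverse r)
  suffix-path {b = b} {c} {ms} k l r eq l≢ r≢ =
    prefix-path (link-sym k) (reverse r) (reverse l)
      (trans (sym (Listₚ.reverse-++ l r)) (trans (cong reverse eq)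
        (trans (Listₚ.unfold-reverse b (ms ++ [ c ])) (cong (_++ [ b ]) (Listₚ.reverse-++ ms [ c ])))))
      (≢[]-reverse r≢) (≢[]-reverse l≢)

  link-hole : ∀ {a b c ms} → Link a b c ms → Hole G
  link-hole {a} {b} {c} {ms} l = record
    { size = suc (suc k)
    ; size≥4 = s≤s (s≤s (k≥2 ms nonempty))
    ; hv = lookup (a ∷ b ∷ ms ++ [ c ])
    ; hinj = hinj′
    ; hinduced = λ i j → mk⇔ (to i j) (from i j)
    }
    where
    open Link l
    k = length (ms ++ [ c ])

    k≥2 : ∀ ms → ms ≢ [] → 2 ≤ length (ms ++ [ c ])
    k≥2 []           ne = contradiction refl ne
    k≥2 (_ ∷ [])     _  = s≤s (s≤s z≤n)
    k≥2 (_ ∷ _ ∷ ms) _  = s≤s (s≤s z≤n)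

    hinj′ : ∀ i j → lookup (a ∷ b ∷ ms ++ [ c ]) i ≡ lookup (a ∷ b ∷ ms ++ [ c ]) j → i ≡ j
    hinj′ zero    zero    _  = refl
    hinj′ zero    (suc j) eq = contradiction eq (lookup-all a∉ j)
    hinj′ (suc i) zero    eq = contradiction (sym eq) (lookup-all a∉ i)
    hinj′ (suc i) (suc j) eq = cong suc (path-lookup-injective path i j eq)

    to-apex : ∀ j → a ~ lookup (b ∷ ms ++ [ c ]) j → CycConsec G (suc (suc k)) zero (suc j)
    to-apex zero    _ = inj₁ refl
    to-apex (suc j) e with suc (toℕ j) ℕ.≟ k
    ... | yes eq = inj₂ (inj₂ (inj₁ (refl , cong (ℕ.suc ∘ ℕ.suc) eq)))
    ... | no ne  = contradiction e (proj₂ (until-lookup-init until j ne))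

    from-apex : ∀ j → CycConsec G (suc (suc k)) zero (suc j) → a ~ lookup (b ∷ ms ++ [ c ]) j
    from-apex zero    _ = a~b
    from-apex (suc j) (inj₁ ())
    from-apex (suc j) (inj₂ (inj₁ ()))
    from-apex (suc j) (inj₂ (inj₂ (inj₁ (_ , eq)))) =
      until-lookup-last until j (ℕₚ.suc-injective (ℕₚ.suc-injective eq))
    from-apex (suc j) (inj₂ (inj₂ (inj₂ (() , _))))

    to : ∀ i j → lookup (a ∷ b ∷ ms ++ [ c ]) i ~ lookup (a ∷ b ∷ ms ++ [ c ]) j →
         CycConsec G (suc (suc k)) i j
    to zero    zero    e = contradiction e ~-irrefl
    to zero    (suc j) e = to-apex j e
    to (suc i) zero    e = consecutive-sym {i = zero} {suc i} (to-apex i (~-sym e))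
    to (suc i) (suc j) e with path-lookup-adj path i j e
    ... | inj₁ eq = inj₁ (cong suc eq)
    ... | inj₂ eq = inj₂ (inj₁ (cong suc eq))

    from : ∀ i j → CycConsec G (suc (suc k)) i j →
           lookup (a ∷ b ∷ ms ++ [ c ]) i ~ lookup (a ∷ b ∷ ms ++ [ c ]) j
    from zero    zero    (inj₁ ())
    from zero    zero    (inj₂ (inj₁ ()))
    from zero    zero    (inj₂ (inj₂ (inj₁ (_ , ()))))
    from zero    zero    (inj₂ (inj₂ (inj₂ (_ , ()))))
    from zero    (suc j) e = from-apex j e
    from (suc i) zero    e = ~-sym (from-apex i (consecutive-sym {i = suc i} {zero} e))
    from (suc i) (suc j) (inj₁ eq) = path-lookup-consecutive path i j (inj₁ (ℕₚ.suc-injective eq))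
    from (suc i) (suc j) (inj₂ (inj₁ eq)) = path-lookup-consecutive path i j (inj₂ (ℕₚ.suc-injective eq))
    from (suc i) (suc j) (inj₂ (inj₂ (inj₁ (() , _))))
    from (suc i) (suc j) (inj₂ (inj₂ (inj₂ (() , _))))

  wheel : ∀ {a b c ms w x y} → Link a b c ms →
          w ~ a → All (w ≢_) (b ∷ ms ++ [ c ]) →
          x ∈ b ∷ ms ++ [ c ] → y ∈ b ∷ ms ++ [ c ] → x ≢ y → w ~ x → w ~ y →
          ContainsWheel G
  wheel {w = w} l w~a w∉ x∈ y∈ x≢y w~x w~y =
    link-hole l , w , off ,
    zero , suc (Any.index x∈) , suc (Any.index y∈) ,
    (λ ()) , (λ ()) , distinct ,
    w~a , subst (w ~_) (lookup-index x∈) w~x , subst (w ~_) (lookup-index y∈) w~y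
    where
    off : ∀ i → hv (link-hole l) i ≢ w
    off zero    eq = ~⇒≢ w~a (sym eq)
    off (suc i) eq = lookup-all w∉ i (sym eq)

    distinct : Fin.suc (Any.index x∈) ≢ suc (Any.index y∈)
    distinct eq = x≢y (trans (lookup-index x∈)
      (trans (cong (lookup _) (suc-injective eq)) (sym (lookup-index y∈))))

  pattern 0F = zero
  pattern 1F = suc zero
  pattern 2F = suc (suc zero)

  pairwise₃ : {A : Set} {R : A → A → Set} → (∀ {x y} → R x y → R y x) → (f : Fin 3 → A) →
              R (f 0F) (f 1F) → R (f 0F) (f 2F) → R (f 1F) (f 2F) →
              ∀ i j → i ≢ j → R (f i) (f j)
  pairwise₃ s f r s′ t 0F 0F ne = contradiction refl ne
  pairwise₃ s f r s′ t 0F 1F ne = r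
  pairwise₃ s f r s′ t 0F 2F ne = s′
  pairwise₃ s f r s′ t 1F 0F ne = s r
  pairwise₃ s f r s′ t 1F 1F ne = contradiction refl ne
  pairwise₃ s f r s′ t 1F 2F ne = t
  pairwise₃ s f r s′ t 2F 0F ne = s s′
  pairwise₃ s f r s′ t 2F 1F ne = s t
  pairwise₃ s f r s′ t 2F 2F ne = contradiction refl ne

  triple : {A : Set} → A → A → A → Fin 3 → A
  triple x y z 0F = x
  triple x y z 1F = y
  triple x y z 2F = z

  lookup-last : {A : Set} → ∀ x xs (y : A) → lookup (x ∷ xs ++ [ y ]) (fromℕ (length (xs ++ [ y ]))) ≡ y
  lookup-last x []       y = refl
  lookup-last x (z ∷ xs) y = lookup-last z xs y

  lookup-interior : ∀ {P : V → Set} {x xs y} → All P xs → ∀ i → 0 < toℕ i → toℕ i < length (xs ++ [ y ]) →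
                    P (lookup (x ∷ xs ++ [ y ]) i)
  lookup-interior ps (suc i) _ i< = until-lookup-init (until-++ {Q = λ _ → ⊤} ps (end tt)) i (ℕₚ.<⇒≢ i<)

  -- Since `a` and `b` are nonadjacent, none of the paths is a single edge, which gives the required
  -- lengths.
  theta : ∀ {a b} xs ys zs → Far a b →
          IsPath (a ∷ xs ++ [ b ]) → IsPath (a ∷ ys ++ [ b ]) → IsPath (a ∷ zs ++ [ b ]) →
          Apart xs ys → Apart xs zs → Apart ys zs → ContainsTheta G
  theta {a} {b} xs ys zs a-b p q r xy xz yz =
    a , b , (λ i → chordlessPath (paths i)) , (λ i → refl , lookup-last a (mid i) b , long (mid i) (paths i)) , far
    where
    mid = triple xs ys zs

    paths : ∀ i → IsPath (a ∷ mid i ++ [ b ])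
    paths 0F = p
    paths 1F = q
    paths 2F = r

    long : ∀ ms → IsPath (a ∷ ms ++ [ b ]) → 2 ≤ length (ms ++ [ b ])
    long []           (cons a~b _ _) = contradiction a~b (proj₂ a-b)
    long (_ ∷ [])     _ = s≤s (s≤s z≤n)
    long (_ ∷ _ ∷ ms) _ = s≤s (s≤s z≤n)

    far : ∀ x y → x ≢ y → ∀ i j → Interior G (chordlessPath (paths x)) i → Interior G (chordlessPath (paths y)) j →
          Far (lookup (a ∷ mid x ++ [ b ]) i) (lookup (a ∷ mid y ++ [ b ]) j)
    far x y x≢y i j (0<i , i<) (0<j , j<) = lookup-interior
      (lookup-interior (pairwise₃ {R = Apart} apart-sym mid xy xz yz x y x≢y) i 0<i i<) j 0<j j<

  -- The contact between two of the paths of a pyramid, with the common apex removed.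
  Meet : List V → List V → Set
  Meet xs ys = Until (λ x → All (Far x) ys) (λ x → Until (Far x) (x ~_) ys) xs

  -- `Meet` treats its two lists differently; this indexed form can be transposed, as `pairwise₃`
  -- requires, and matches the definition of a pyramid.
  Meet′ : List V → List V → Set
  Meet′ xs ys = ∀ (i : Fin (length xs)) (j : Fin (length ys)) →
    lookup xs i ≢ lookup ys j ×
    (lookup xs i ~ lookup ys j ⇔ (suc (toℕ i) ≡ length xs × suc (toℕ j) ≡ length ys))

  meet′-sym : ∀ {xs ys} → Meet′ xs ys → Meet′ ys xs
  meet′-sym m i j with m j i
  ... | ne , e = ne ∘ sym , mk⇔ (swap ∘ Equivalence.to e ∘ ~-sym) (~-sym ∘ Equivalence.from e ∘ swap)

  meet⇒meet′ : ∀ {xs ys} → Meet xs ys → Meet′ xs ys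
  meet⇒meet′ {xs} {ys} m i j with suc (toℕ i) ℕ.≟ length xs | suc (toℕ j) ℕ.≟ length ys
  ... | no i-init | _ =
    let f = lookup-all (until-lookup-init m i i-init) j in
    proj₁ f , mk⇔ (λ e → contradiction e (proj₂ f)) (λ l → contradiction (proj₁ l) i-init)
  ... | yes i-last | no j-init =
    let f = until-lookup-init (until-lookup-last m i i-last) j j-init in
    proj₁ f , mk⇔ (λ e → contradiction e (proj₂ f)) (λ l → contradiction (proj₂ l) j-init)
  ... | yes i-last | yes j-last =
    let e = until-lookup-last (until-lookup-last m i i-last) j j-last in
    ~⇒≢ e , mk⇔ (λ _ → i-last , j-last) (λ _ → e)

  pyramid : ∀ {a xs ys zs} → IsPath (a ∷ xs) → IsPath (a ∷ ys) → IsPath (a ∷ zs) →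
            2 ≤ length xs ⊎ 2 ≤ length ys → 2 ≤ length zs →
            Meet xs ys → Meet xs zs → Meet ys zs → ContainsPyramid G
  pyramid {a} {xs} {ys} {zs} p q r xy≥2 z≥2 xy xz yz =
    a , (λ i → chordlessPath (paths i)) , (λ i → refl , long i) , two xy≥2 , meets
    where
    leg = triple xs ys zs

    paths : ∀ i → IsPath (a ∷ leg i)
    paths 0F = p
    paths 1F = q
    paths 2F = r

    until-nonempty : ∀ {P Q xs} → Until P Q xs → 1 ≤ length xs
    until-nonempty (end _) = s≤s z≤n
    until-nonempty (_ ∷ _) = s≤s z≤n

    long : ∀ i → 1 ≤ length (leg i)
    long 0F = until-nonempty xy
    long 1F = until-nonempty yz
    long 2F = ℕₚ.≤-trans (s≤s z≤n) z≥2

    two : 2 ≤ length xs ⊎ 2 ≤ length ys →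
          Σ (Fin 3) λ i → Σ (Fin 3) λ j → i ≢ j × 2 ≤ length (leg i) × 2 ≤ length (leg j)
    two (inj₁ x≥2) = 0F , 2F , (λ ()) , x≥2 , z≥2
    two (inj₂ y≥2) = 1F , 2F , (λ ()) , y≥2 , z≥2

    meets : ∀ x y → x ≢ y → ∀ (i : Fin (suc (length (leg x)))) (j : Fin (suc (length (leg y)))) → 0 < toℕ i → 0 < toℕ j →
      lookup (a ∷ leg x) i ≢ lookup (a ∷ leg y) j ×
      (lookup (a ∷ leg x) i ~ lookup (a ∷ leg y) j ⇔ (toℕ i ≡ length (leg x) × toℕ j ≡ length (leg y)))
    meets x y x≢y (suc i) (suc j) _ _ =
      pairwise₃ {R = Meet′} (λ {xs} {ys} → meet′-sym {xs} {ys}) leg (meet⇒meet′ xy) (meet⇒meet′ xz) (meet⇒meet′ yz) x y x≢y i j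

  -- Deciding the existence of a clique cutset

  reach-∷ʳ : ∀ {S u v w} → ReachOutside G S u v → v ~ w → w ∉ₛ S → ReachOutside G S u w
  reach-∷ʳ (here u∉)     v~w w∉ = step u∉ v~w (here w∉)
  reach-∷ʳ (step u∉ a r) v~w w∉ = step u∉ a (reach-∷ʳ r v~w w∉)

  record Component (S : Subset n) (u : V) : Set where
    field
      X         : Subset n
      u∈X       : u ∈ₛ X
      reachable : ∀ {x} → x ∈ₛ X → ReachOutside G S u x
      closed    : ∀ {x y} → x ∈ₛ X → x ~ y → y ∉ₛ S → y ∈ₛ X

    complete : ∀ {x v} → x ∈ₛ X → ReachOutside G S x v → v ∈ₛ X
    complete x∈ (here _)              = x∈
    complete x∈ (step _ x~y (here y∉)) = closed x∈ x~y y∉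
    complete x∈ (step _ x~y r@(step y∉ _ _)) = complete (closed x∈ x~y y∉) r

  -- Saturation: neighbours outside `S` are added one at a time. The set grows strictly, so this
  -- ends, and it ends with a closed set.
  component : ∀ S u → u ∉ₛ S → Component S u
  component S u u∉ = grow ⁅ u ⁆ (⊃-wellFounded _) (x∈⁅x⁆ u)
      λ x∈ → subst (ReachOutside G S u) (sym (x∈⁅y⁆⇒x≡y u x∈)) (here u∉)
    where
    grow : ∀ X → Acc _⊃ₛ_ X → u ∈ₛ X → (∀ {x} → x ∈ₛ X → ReachOutside G S u x) → Component S u
    grow X (acc rec) u∈ reach
      with ∃? (λ y → ¬? (y ∈? X) ×-dec ¬? (y ∈? S) ×-dec ∃? (λ x → x ∈? X ×-dec x ~? y))
    ... | no none = record
      { X = X ; u∈X = u∈ ; reachable = reach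
      ; closed = λ {x} {y} x∈ x~y y∉S →
          decidable-stable (y ∈? X) λ y∉X → none (y , y∉X , y∉S , x , x∈ , x~y) }
    ... | yes (y , y∉X , y∉S , x , x∈ , x~y) =
      grow (X ∪ ⁅ y ⁆) (rec (p⊆p∪q ⁅ y ⁆ , y , x∈p∪q⁺ (inj₂ (x∈⁅x⁆ y)) , y∉X)) (p⊆p∪q ⁅ y ⁆ u∈) reach′
      where
      reach′ : ∀ {z} → z ∈ₛ X ∪ ⁅ y ⁆ → ReachOutside G S u z
      reach′ z∈ with x∈p∪q⁻ X ⁅ y ⁆ z∈
      ... | inj₁ z∈X = reach z∈X
      ... | inj₂ z∈y with refl ← x∈⁅y⁆⇒x≡y y z∈y = reach-∷ʳ (reach x∈) x~y y∉S

  reach? : ∀ S u v → Dec (ReachOutside G S u v)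
  reach? S u v with u ∈? S
  ... | yes u∈ = no λ { (here u∉) → u∉ u∈ ; (step u∉ _ _) → u∉ u∈ }
  ... | no u∉ with component S u u∉
  ... | C with v ∈? Component.X C
  ... | yes v∈ = yes (Component.reachable C v∈)
  ... | no v∉  = no (v∉ ∘ Component.complete C (Component.u∈X C))

  cliqueCutset? : Dec (HasCliqueCutset G)
  cliqueCutset? = anySubset? λ S →
    all? (λ u → all? λ v → u ∈? S →-dec v ∈? S →-dec ¬? (u ≟ v) →-dec u ~? v) ×-dec
    ∃? (λ u → ∃? λ v → ¬? (u ∈? S) ×-dec ¬? (v ∈? S) ×-dec ¬? (reach? S u v))

  module _ {P : V → Set} (P? : Decidable P) where

    -- All uses of the absence of clique cutsets pass through here: a decidable clique separates no
    -- two nodes outside it.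
    connect : ¬ HasCliqueCutset G → (∀ u v → P u → P v → u ≢ v → u ~ v) →
              ∀ {u v} → ¬ P u → ¬ P v → Walk (λ w → ¬ P w) (λ w → w ≡ v × ¬ P w) u
    connect no-cutset P-clique {u} {v} ¬Pu ¬Pv = walk (decidable-stable (reach? S u v) λ ¬r → no-cutset
        (S , (λ x y x∈ y∈ → P-clique x y (∈⁻ x∈) (∈⁻ y∈)) , u , v , ¬Pu ∘ ∈⁻ , ¬Pv ∘ ∈⁻ , ¬r))
      where
      S = comprehension P?
      ∈⁻ = ∈-comprehension⁻ P?
      walk : ∀ {u} → ReachOutside G S u v → Walk (λ w → ¬ P w) (λ w → w ≡ v × ¬ P w) u
      walk (here v∉)       = stop (refl , ¬Pv)
      walk (step u∉ u~w r) = step (u∉ ∘ ∈-comprehension⁺ P?) u~w (walk r)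

  module _ (no-theta : ¬ ContainsTheta G) (no-wheel : ¬ ContainsWheel G) (no-pyramid : ¬ ContainsPyramid G) where

    -- Attachments to a hole

    split-first : ∀ {P : V → Set} {xs} → FirstHit {P = P} xs →
                  ∃ λ l → ∃ λ x → ∃ λ r → l ++ x ∷ r ≡ xs × All (¬_ ∘ P) l × P x
    split-first (first-hit ¬l p) = _ , _ , _ , refl , ¬l , p

    split-last : ∀ {P : V → Set} {xs} → LastHit {P = P} xs →
                 ∃ λ l → ∃ λ x → ∃ λ r → l ++ x ∷ r ≡ xs × P x × All (¬_ ∘ P) r
    split-last (last-hit p ¬r) = _ , _ , _ , refl , p , ¬r

    all-far : ∀ {q xs} → All (q ≢_) xs → All (¬_ ∘ (q ~_)) xs → All (Far q) xs
    all-far []       []       = []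
    all-far (n ∷ ns) (a ∷ as) = (n , a) ∷ all-far ns as

    all-reverse-∷ : ∀ {P : V → Set} {x xs} → All P (x ∷ xs) → All P (reverse xs ++ [ x ])
    all-reverse-∷ (p ∷ ps) = Allₚ.++⁺ (all-reverse ps) (p ∷ [])

    ∷ʳ≢[] : ∀ (xs : List V) {x} → xs ++ [ x ] ≢ []
    ∷ʳ≢[] [] ()
    ∷ʳ≢[] (_ ∷ _) ()

    -- With x and y the first and last neighbours of q on the rim, the three paths are
    -- the two arcs from a to x and to y and the path a ∷ Q ++ [ q ].
    module Tripod {a b c ms} (k : Link a b c ms) (Q : List V) {q} (pathQ : IsPath (a ∷ Q ++ [ q ]))
      (Q-apart : Apart Q (b ∷ ms ++ [ c ])) (q∉ : All (q ≢_) (b ∷ ms ++ [ c ])) (any : Any (q ~_) ms) where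

      open Link k

      -- As `q` sees a node of `ms`, its only neighbour `x` is neither `b` nor `c`. So `x` is far
      -- from `a`, and the three paths form a theta with ends `a` and `x`.
      one : ∀ l x r → l ++ x ∷ r ≡ b ∷ ms ++ [ c ] →
            All (¬_ ∘ (q ~_)) l → q ~ x → All (¬_ ∘ (q ~_)) r → ⊥
      one [] x r refl _ _ ¬r = All¬⇒¬Any ¬r (Anyₚ.++⁺ˡ any)
      one (z ∷ l) x [] eq ¬l _ _ =
        All¬⇒¬Any (subst (All _) (Listₚ.∷ʳ-injectiveˡ (z ∷ l) (b ∷ ms) eq) ¬l) (there any)
      one (w ∷ l) x (z ∷ r) eq ¬l q~x ¬r = no-theta (theta (w ∷ l) (reverse (z ∷ r)) (Q ++ [ q ]) a-x
        (prefix-path k (w ∷ l ++ [ x ]) (z ∷ r) eq′ (λ ()) (λ ()))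
        (subst (λ s → IsPath (a ∷ s)) (Listₚ.unfold-reverse x (z ∷ r))
          (suffix-path k (w ∷ l) (x ∷ z ∷ r) eq (λ ()) (λ ())))
        (path-∷ʳ pathQ (until-++ (a-x ∷ All.map (All.head ∘ Allₚ.++⁻ʳ (w ∷ l)) Q-apart′) (end q~x)))
        (All.map all-reverse (path-sep (w ∷ l) path′))
        (apart-sym (Allₚ.++⁺ (All.map (Allₚ.++⁻ˡ (w ∷ l)) Q-apart′)
          (all-far (Allₚ.++⁻ˡ (w ∷ l) q∉′) ¬l ∷ [])))
        (apart-sym (Allₚ.++⁺ (All.map (all-reverse ∘ All.tail ∘ Allₚ.++⁻ʳ (w ∷ l)) Q-apart′)
          (all-reverse (all-far (All.tail (Allₚ.++⁻ʳ (w ∷ l) q∉′)) ¬r) ∷ []))))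
        where
        eq′ = trans (Listₚ.++-assoc (w ∷ l) [ x ] (z ∷ r)) eq
        Q-apart′ = subst (Apart Q) (sym eq) Q-apart
        q∉′ = subst (All (q ≢_)) (sym eq) q∉
        path′ = subst IsPath (sym eq) path
        a-x : Far a x
        a-x = All.head (Allₚ.++⁻ʳ l (until-init (l ++ [ x ])
                (subst (Until _ _) (sym (Listₚ.∷-injectiveʳ eq′)) until)))

      -- If `Q` is empty, `q` is the hub of a wheel with spokes to `a`, `x`, `y`. Otherwise `a` is
      -- far from `q`: adjacent `x`, `y` give a pyramid with apex `a` and triangle `x`, `y`, `q`,
      -- and nonadjacent ones a theta with ends `a` and `q`. Neighbours of `q` strictly between `x`
      -- and `y` lie on none of these paths.
      two : ∀ l x m y r → l ++ x ∷ m ++ y ∷ r ≡ b ∷ ms ++ [ c ] →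
            All (¬_ ∘ (q ~_)) l → q ~ x → q ~ y → All (¬_ ∘ (q ~_)) r → ⊥
      two l x m y r eq ¬l q~x q~y ¬r = cases Q pathQ Q-left Q-right m path′ eq
        where
        x∈ : x ∈ b ∷ ms ++ [ c ]
        x∈ = subst (x ∈_) eq (Anyₚ.++⁺ʳ l (here refl))
        y∈ : y ∈ b ∷ ms ++ [ c ]
        y∈ = subst (y ∈_) eq (Anyₚ.++⁺ʳ l (there (Anyₚ.++⁺ʳ m (here refl))))
        path′ = subst IsPath (sym eq) path
        x≢y : x ≢ y
        x≢y = All.head (Allₚ.++⁻ʳ m (path-∉ (path-++ʳ l path′)))
        eq′ : (l ++ [ x ]) ++ m ++ y ∷ r ≡ b ∷ ms ++ [ c ]
        eq′ = trans (Listₚ.++-assoc l [ x ] (m ++ y ∷ r)) eq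
        eq″ : (l ++ x ∷ m) ++ y ∷ r ≡ b ∷ ms ++ [ c ]
        eq″ = trans (Listₚ.++-assoc l (x ∷ m) (y ∷ r)) eq
        ≢[] : ∀ l {z zs} → l ++ z ∷ zs ≢ []
        ≢[] [] ()
        ≢[] (_ ∷ _) ()
        left : IsPath (a ∷ l ++ [ x ])
        left = prefix-path k (l ++ [ x ]) (m ++ y ∷ r) eq′ (∷ʳ≢[] l) (≢[] m)
        right : IsPath (a ∷ reverse r ++ [ y ])
        right = subst (λ s → IsPath (a ∷ s)) (Listₚ.unfold-reverse y r)
          (suffix-path k (l ++ x ∷ m) (y ∷ r) eq″ (≢[] l) (λ ()))
        Q-left : Apart Q (l ++ [ x ])
        Q-left = All.map (Allₚ.++⁻ˡ (l ++ [ x ])) (subst (Apart Q) (sym eq′) Q-apart)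
        Q-right : Apart Q (reverse r ++ [ y ])
        Q-right = All.map (all-reverse-∷ ∘ Allₚ.++⁻ʳ (l ++ x ∷ m)) (subst (Apart Q) (sym eq″) Q-apart)
        q-l : All (Far q) l
        q-l = all-far (Allₚ.++⁻ˡ l (subst (All _) (sym eq) q∉)) ¬l
        q-r : All (Far q) (reverse r)
        q-r = all-reverse (all-far (All.tail (Allₚ.++⁻ʳ (l ++ x ∷ m) (subst (All _) (sym eq″) q∉))) ¬r)

        -- If both arcs were single edges, adjacent `x` and `y` would be `b` and `c`, leaving `ms`
        -- empty.
        long : ∀ (xs ys : List V) {x y} → xs ++ x ∷ y ∷ ys ≡ b ∷ ms ++ [ c ] →
               2 ≤ length (xs ++ [ x ]) ⊎ 2 ≤ length (reverse ys ++ [ y ])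
        long []           []       eq = contradiction
          (sym (Listₚ.∷ʳ-injectiveˡ [] ms (Listₚ.∷-injectiveʳ eq))) nonempty
        long (_ ∷ [])     _        _  = inj₁ (s≤s (s≤s z≤n))
        long (_ ∷ _ ∷ _)  _        _  = inj₁ (s≤s (s≤s z≤n))
        long []           (z ∷ ys) _  = inj₂ (two′ (reverse (z ∷ ys)) (≢[]-reverse {z ∷ ys} λ ()))
          where
          two′ : ∀ (xs : List V) → xs ≢ [] → ∀ {y} → 2 ≤ length (xs ++ [ y ])
          two′ []          ne = contradiction refl ne
          two′ (_ ∷ [])    _  = s≤s (s≤s z≤n)
          two′ (_ ∷ _ ∷ _) _  = s≤s (s≤s z≤n)

        cases : ∀ Q → IsPath (a ∷ Q ++ [ q ]) → Apart Q (l ++ [ x ]) → Apart Q (reverse r ++ [ y ]) →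
                ∀ m → IsPath (l ++ x ∷ m ++ y ∷ r) → l ++ x ∷ m ++ y ∷ r ≡ b ∷ ms ++ [ c ] → ⊥
        cases [] (cons a~q _ _) _ _ _ _ _ =
          no-wheel (wheel k (~-sym a~q) q∉ x∈ y∈ x≢y q~x q~y)
        cases (t ∷ Q′) pathQ Q-left Q-right [] path″ eq with cons x~y x-r _ ← path-++ʳ l path″ =
          no-pyramid (pyramid left right pathQ (long l r eq) (long′ Q′)
            (until-++ (All.map all-reverse-∷ (path-sep l path″)) (end (until-++ (all-reverse x-r) (end x~y))))
            (until-++ (All.map (λ (f , f′) → Allₚ.++⁺ f (far-sym f′ ∷ [])) (All.zip
                (apart-sym (All.map (Allₚ.++⁻ˡ l) Q-left) , q-l)))
              (end (until-++ (All.map (far-sym ∘ All.head ∘ Allₚ.++⁻ʳ l) Q-left) (end (~-sym q~x)))))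
            (until-++ (All.map (λ (f , f′) → Allₚ.++⁺ f (far-sym f′ ∷ [])) (All.zip
                (apart-sym (All.map (Allₚ.++⁻ˡ (reverse r)) Q-right) , q-r)))
              (end (until-++ (All.map (far-sym ∘ All.head ∘ Allₚ.++⁻ʳ (reverse r)) Q-right) (end (~-sym q~y))))))
          where
          long′ : ∀ Q′ → 2 ≤ length (t ∷ Q′ ++ [ q ])
          long′ []      = s≤s (s≤s z≤n)
          long′ (_ ∷ _) = s≤s (s≤s z≤n)
        cases (t ∷ Q′) pathQ@(cons _ a-Q _) Q-left Q-right (m₀ ∷ m′) path″ eq =
          no-theta (theta (l ++ [ x ]) (reverse r ++ [ y ]) (t ∷ Q′) a-q
            (path-∷ʳ left (until-++ (a-q ∷ All.map far-sym q-l) (end (~-sym q~x))))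
            (path-∷ʳ right (until-++ (a-q ∷ All.map far-sym q-r) (end (~-sym q~y))))
            pathQ
            (All.map (all-reverse-∷ ∘ Allₚ.++⁻ʳ m′) (path-sep (l ++ [ x ])
              (subst IsPath (sym (Listₚ.++-assoc l [ x ] (m₀ ∷ m′ ++ y ∷ r))) path″)))
            (apart-sym Q-left) (apart-sym Q-right))
          where
          a-q : Far a q
          a-q = All.head (Allₚ.++⁻ʳ Q′ a-Q)

      absurd : ⊥
      absurd with split-first (firstHit (q ~?_) (there {x = b} (Anyₚ.++⁺ˡ {ys = [ c ]} any)))
      ... | l , x , r , eq , ¬l , q~x with any? (q ~?_) r
      ... | no none = one l x r eq ¬l q~x (¬Any⇒All¬ r none)
      ... | yes some with split-last (lastHit (q ~?_) some)
      ... | m , y , r′ , refl , q~y , ¬r = two l x m y r′ eq ¬l q~x q~y ¬r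

    -- A tripod with empty `Q` and `t` in the role of `q`: one neighbour on the path from `b` to `c`
    -- gives a theta, several give a wheel.
    star : ∀ {a b c ms t} → Link a b c ms → t ~ a → Far t b → Far t c → ¬ Any (t ~_) ms
    star k t~a t-b t-c = Tripod.absurd k [] (cons (~-sym t~a) [] single) []
      (proj₁ t-b ∷ Allₚ.++⁺ (All.map (λ a-m → far-from (~-sym t~a) a-m ∘ sym) apart) (proj₁ t-c ∷ []))
      where open Link k

    far-neighbour : ∀ {a c L} → a ~ c → All (Far a) L → All (¬_ ∘ (c ~_)) L → All (λ z → Far z c) L
    far-neighbour a~c []       []       = []
    far-neighbour a~c (f ∷ fs) (n ∷ ns) = (far-from a~c f , n ∘ ~-sym) ∷ far-neighbour a~c fs ns

    prefix-link : ∀ {a t c} → a ~ t → a ~ c → Far t c → ∀ L {q r} → IsPath (t ∷ L ++ q ∷ r) →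
                  All (Far a) (L ++ q ∷ r) → All (¬_ ∘ (c ~_)) L → c ~ q → Link a t c (L ++ [ q ])
    prefix-link a~t a~c t-c L {q} {r} path aL ¬L c~q = record
      { a~b = a~t ; a~c = a~c ; b-c = t-c
      ; path = path-∷ʳ (path-prefix (_ ∷ L) path)
          (until-++ (t-c ∷ far-neighbour a~c (Allₚ.++⁻ˡ L aL) ¬L) (end (~-sym c~q)))
      ; apart = Allₚ.++⁺ (Allₚ.++⁻ˡ L aL) (All.head (Allₚ.++⁻ʳ L aL) ∷ []) }

    split-snoc : ∀ {P Q xs} → Until P Q xs → ∃ λ l → ∃ λ x → l ++ [ x ] ≡ xs × All P l × Q x
    split-snoc u with until-snoc u
    ... | snoc ps q = _ , _ , refl , ps , q

    until-all : ∀ {P Q R : V → Set} {xs} → (∀ {x} → P x → R x) → (∀ {x} → Q x → R x) → Until P Q xs → All R xs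
    until-all f g (end q) = g q ∷ []
    until-all f g (p ∷ u) = f p ∷ until-all f g u

    -- Otherwise the approach, continued by b or by c, closes a hole through a and t at which the
    -- remaining one of b and c contradicts star.
    approach-avoids : ∀ {a b c ms t L} → Link a b c ms → t ~ a → Far t b → Far t c →
      IsPath (t ∷ L) → All (Far a) L →
      Until (λ u → All (Far u) ms) (λ u → All (u ≢_) ms × Any (u ~_) ms) (t ∷ L) →
      ¬ Any (b ~_) L
    approach-avoids {a} {b} {c} {ms} {t} k t~a t-b t-c pathL aL u any with firstHit (b ~?_) any
    ... | first-hit {l} {q} {r} ¬l b~q with any? (c ~?_) r
      -- In the hole through `a`, `t`, `l`, `q`, `b`, the outside neighbour `c` of `a` cannot see
      -- `l` or `q`; so `c` meets `L` after `q` or not at all.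
      | star (prefix-link (~-sym t~a) (Link.a~b k) t-b l pathL aL ¬l b~q)
             (~-sym (Link.a~c k)) (far-sym t-c) (far-sym (Link.b-c k))
    ... | yes c~r | ¬c with firstHit (c ~?_) c~r
    ... | first-hit {l₂} {q₂} {r₂} ¬l₂ c~q₂ =
      -- The path is closed at the first neighbour of `c`; `b` sees the interior node `q` of this
      -- hole.
      star (prefix-link (~-sym t~a) a~c t-c (l ++ q ∷ l₂)
              (subst (λ z → IsPath (t ∷ z)) (sym assoc) pathL) (subst (All _) (sym assoc) aL)
              (Allₚ.++⁺ (Allₚ.++⁻ˡ l ¬lq) (All.head (Allₚ.++⁻ʳ l ¬lq) ∷ ¬l₂)) c~q₂)
        (~-sym a~b) (far-sym t-b) b-c (Anyₚ.++⁺ˡ (Anyₚ.++⁺ʳ l (here b~q)))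
      where
      open Link k
      assoc = Listₚ.++-assoc l (q ∷ l₂) (q₂ ∷ r₂)
      ¬lq = ¬Any⇒All¬ (l ++ [ q ]) ¬c
    approach-avoids {a} {b} {c} {ms} {t} k t~a t-b t-c pathL aL u any
      | first-hit {l} {q} {r} ¬l b~q | no ¬r | ¬c with split-snoc u
    ... | L₀ , z , eq , ps , z∉ , z~ with split-last (lastHit (z ~?_) z~)
    ... | m₁ , s , m₂ , refl , z~s , ¬m₂ =
      -- Here `c` misses `L`, so the path goes on from its end `z` to the last neighbour `s` of `z`
      -- in `ms` and along the rim to `c`; again `b` sees `q`.
      star link (~-sym a~b) (far-sym t-b) b-c (Anyₚ.++⁺ˡ (Anyₚ.++⁺ʳ l (here b~q)))
      where
      open Link k
      L = l ++ q ∷ r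
      ¬lq = ¬Any⇒All¬ (l ++ [ q ]) ¬c

      L-c : All (λ z → Far z c) (L₀ ++ [ z ])
      L-c = subst (All _) (sym eq) (t-c ∷ far-neighbour a~c aL
        (Allₚ.++⁺ (Allₚ.++⁻ˡ l ¬lq) (All.head (Allₚ.++⁻ʳ l ¬lq) ∷ ¬Any⇒All¬ r ¬r)))

      apart-end : ∀ {L} → All (λ u → All (Far u) (m₁ ++ s ∷ m₂)) L → All (λ z → Far z c) L →
                  All (λ u → All (Far u) (s ∷ m₂ ++ [ c ])) L
      apart-end []       []       = []
      apart-end (f ∷ fs) (g ∷ gs) = Allₚ.++⁺ (Allₚ.++⁻ʳ m₁ f) (g ∷ []) ∷ apart-end fs gs

      joined : IsPath ((t ∷ L) ++ s ∷ (m₂ ++ [ c ]))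
      joined = path-join pathL
        (path-++ʳ (b ∷ m₁) (subst (λ z → IsPath (b ∷ z)) (Listₚ.++-assoc m₁ (s ∷ m₂) [ c ]) path))
        (subst (Until _ _) eq (until-++ (apart-end ps (Allₚ.++⁻ˡ L₀ L-c))
          (end (z~s , Allₚ.++⁺ (all-far (All.tail (Allₚ.++⁻ʳ m₁ z∉)) ¬m₂)
            (All.head (Allₚ.++⁻ʳ L₀ L-c) ∷ [])))))

      link : Link a t c (L ++ s ∷ m₂)
      link = record
        { a~b = ~-sym t~a ; a~c = a~c ; b-c = t-c
        ; path = subst (λ z → IsPath (t ∷ z)) (sym (Listₚ.++-assoc L (s ∷ m₂) [ c ])) joined
        ; apart = Allₚ.++⁺ aL (Allₚ.++⁻ʳ m₁ apart) }

    -- The walk says that v lies in the component of G ∖ N[a] containing ms.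
    attached : ∀ {a b c ms t v} → Link a b c ms → t ~ a → Far t b → Far t c →
               t ~ v → Walk (Far a) (_∈ ms) v → ⊥
    -- The induced path from `t` to the first node `q` that sees `ms` touches the path from `b` to
    -- `c` only through `q`, so it is the third path of a tripod.
    attached {a} {b} {c} {ms} {t} {v} k t~a t-b t-c t~v w = Tripod.absurd k Q
        (subst (λ z → IsPath (a ∷ z)) (sym eq) (cons (~-sym t~a) aL pathL))
        (apart-Q (All.map proj₂ ps) (Allₚ.++⁻ˡ Q L-b) (Allₚ.++⁻ˡ Q L-c))
        (proj₁ (All.head (Allₚ.++⁻ʳ Q L-b)) ∷ Allₚ.++⁺ q∉ (proj₁ (All.head (Allₚ.++⁻ʳ Q L-c)) ∷ []))
        q~
      where
      open Link k

      Near : V → Set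
      Near u = u ≡ t ⊎ Far a u

      near : ∀ {v} → Walk (Far a) (_∈ ms) v → Near v
      near (stop v∈)    = inj₂ (All.lookup apart v∈)
      near (step f _ _) = inj₂ f

      -- A walk starting off `ms` passes a node that sees `ms` before it enters `ms`; it is stopped
      -- at the first such node.
      approach : ∀ {u} → ¬ u ∈ ms → Walk (Far a) (_∈ ms) u →
                 Walk (λ u → Near u × All (Far u) ms) (λ u → Near u × All (u ≢_) ms × Any (u ~_) ms) u
      approach {u} u∉ w with any? (u ~?_) ms
      approach {u} u∉ w                | yes hit = stop (near w , ¬Any⇒All¬ ms u∉ , hit)
      approach u∉ (stop u∈)            | no miss = contradiction u∈ u∉
      approach {u} u∉ (step f u~v w)   | no miss =
        step (inj₂ f , all-far (¬Any⇒All¬ ms u∉) (¬Any⇒All¬ ms miss)) u~v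
          (approach (λ v∈ → miss (Any.map (λ { refl → u~v }) v∈)) w)

      start : Walk (λ u → Near u × All (Far u) ms) (λ u → Near u × All (u ≢_) ms × Any (u ~_) ms) t
      start = step (inj₁ refl , all-far (¬Any⇒All¬ ms t∉) (¬Any⇒All¬ ms miss)) t~v
          (approach (λ v∈ → miss (Any.map (λ { refl → t~v }) v∈)) w)
        where
        t∉ : ¬ t ∈ ms
        t∉ t∈ = proj₂ (All.lookup apart t∈) (~-sym t~a)
        miss = star k t~a t-b t-c

      L = proj₁ (route start)
      pathL = proj₁ (proj₂ (route start))
      untilL = proj₂ (proj₂ (route start))

      -- Only `t` may be adjacent to `a`, and an induced path does not return to its first node.
      aL : All (Far a) L
      aL = All.map (λ { (t≢u , inj₁ u≡t) → contradiction (sym u≡t) t≢u ; (_ , inj₂ f) → f })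
             (All.zip (path-∉ pathL , All.tail (until-all proj₁ proj₁ untilL)))

      split = split-snoc untilL
      Q = proj₁ split
      q = proj₁ (proj₂ split)
      eq : Q ++ [ q ] ≡ t ∷ L
      eq = proj₁ (proj₂ (proj₂ split))
      ps = proj₁ (proj₂ (proj₂ (proj₂ split)))
      q∉ = proj₁ (proj₂ (proj₂ (proj₂ (proj₂ (proj₂ split)))))
      q~ = proj₂ (proj₂ (proj₂ (proj₂ (proj₂ (proj₂ split)))))

      L-b : All (λ z → Far z b) (Q ++ [ q ])
      L-b = subst (All _) (sym eq) (t-b ∷ far-neighbour a~b aL (¬Any⇒All¬ L
        (approach-avoids k t~a t-b t-c pathL aL (until-map proj₂ proj₂ untilL))))

      L-c : All (λ z → Far z c) (Q ++ [ q ])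
      L-c = subst (All _) (sym eq) (t-c ∷ far-neighbour a~c aL (¬Any⇒All¬ L
        (approach-avoids (link-sym k) t~a t-c t-b pathL aL
          (until-map (all-reverse ∘ proj₂)
            (λ (_ , ∉ , hit) → all-reverse ∉ , Anyₚ.reverse⁺ hit) untilL))))

      apart-Q : ∀ {Q} → All (λ u → All (Far u) ms) Q → All (λ z → Far z b) Q → All (λ z → Far z c) Q →
                Apart Q (b ∷ ms ++ [ c ])
      apart-Q []       []       []       = []
      apart-Q (f ∷ fs) (g ∷ gs) (h ∷ hs) = (g ∷ Allₚ.++⁺ f (h ∷ [])) ∷ apart-Q fs gs hs

    -- Two adjacent nodes seeing both ends of a path

    all-prefix : ∀ {P : V → Set} xs {y ys} → All P (xs ++ y ∷ ys) → All P (xs ++ [ y ])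
    all-prefix xs all = Allₚ.++⁺ (Allₚ.++⁻ˡ xs all) (All.head (Allₚ.++⁻ʳ xs all) ∷ [])

    chord-link : ∀ {b c p l x r} → b ~ c → b ~ x → IsPath (c ∷ p ∷ l ++ x ∷ r) →
                 All (b ≢_) (p ∷ l ++ x ∷ r) → All (¬_ ∘ (b ~_)) (p ∷ l) → Link b c x (p ∷ l)
    chord-link {c = c} {p} {l} b~c b~x path@(cons _ f _) b∉ ¬l = record
      { a~b = b~c ; a~c = b~x ; b-c = All.head (Allₚ.++⁻ʳ l f) ; path = path-prefix (c ∷ p ∷ l) path
      ; apart = all-far (Allₚ.++⁻ˡ (p ∷ l) b∉) ¬l }

    -- The first neighbour of `a` beyond `x` closes a hole through `a` and `c` in which `b` sees
    -- `a`, `c` and `x`.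
    fan-miss : ∀ {a b c p l x r} → a ~ b → a ~ c → b ~ c → IsPath (c ∷ p ∷ l ++ x ∷ r) →
               All (a ≢_) (c ∷ p ∷ l ++ x ∷ r) → All (b ≢_) (c ∷ p ∷ l ++ x ∷ r) → b ~ x →
               All (¬_ ∘ (a ~_)) (p ∷ l ++ [ x ]) → ¬ Any (a ~_) r
    fan-miss {a} {b} {c} {p} {l} {x} a~b a~c b~c path a∉ b∉ b~x (¬p ∷ ¬lx) hit with firstHit (a ~?_) hit
    ... | first-hit {l₂} {y} {r₂} ¬l₂ a~y = no-wheel (wheel link (~-sym a~b)
      (all-prefix (c ∷ p ∷ l ++ x ∷ l₂) (subst (λ z → All (b ≢_) (c ∷ p ∷ z)) assoc b∉)) (here refl)
      (there (there (Anyₚ.++⁺ˡ (Anyₚ.++⁺ʳ l (here refl)))))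
      (All.head (Allₚ.++⁻ʳ l (All.tail (path-∉ path)))) b~c b~x)
      where
      assoc = sym (Listₚ.++-assoc l (x ∷ l₂) (y ∷ r₂))
      link : Link a c y (p ∷ l ++ x ∷ l₂)
      link = chord-link a~c a~y (subst (λ z → IsPath (c ∷ p ∷ z)) assoc path)
        (subst (λ z → All (a ≢_) (p ∷ z)) assoc (All.tail a∉))
        (¬p ∷ Allₚ.++⁺ (Allₚ.++⁻ˡ l ¬lx) (All.head (Allₚ.++⁻ʳ l ¬lx) ∷ ¬l₂))

    -- If `b` misses `p`, its first neighbour `x` after `p` closes a hole through `b` and `c`. A
    -- neighbour of `a` on it other than `b` and `c` makes `a` a hub; otherwise `d` lies beyond `x`
    -- and `fan-miss` applies.
    fan : ∀ {a b c d p L} → a ~ b → a ~ c → b ~ c → a ~ d → b ~ d →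
          IsPath (c ∷ p ∷ L) → d ∈ L → All (a ≢_) (c ∷ p ∷ L) → All (b ≢_) (c ∷ p ∷ L) → b ~ p
    fan {a} {b} {c} {d} {p} {L} a~b a~c b~c a~d b~d path d∈ a∉ b∉ with b ~? p
    ... | yes b~p = b~p
    ... | no b≁p with firstHit (b ~?_) (Any.map (λ { refl → b~d }) d∈)
    ... | first-hit {l} {x} {r} ¬l b~x with any? (a ~?_) (p ∷ l ++ [ x ])
    ... | no miss = ⊥-elim (fan-miss a~b a~c b~c path a∉ b∉ b~x (¬Any⇒All¬ _ miss) a~r)
      where
      a~r : Any (a ~_) r
      a~r with Anyₚ.++⁻ (l ++ [ x ]) (subst (Any (a ~_)) (sym (Listₚ.++-assoc l [ x ] r))
                                     (Any.map (λ { refl → a~d }) d∈))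
      ... | inj₁ hit = contradiction (there hit) miss
      ... | inj₂ hit = hit
    ... | yes hit with find hit
    ... | z , z∈ , a~z =
      contradiction (wheel link a~b (all-prefix (c ∷ p ∷ l) a∉) (here refl) (there z∈)
        (All.lookup (path-∉ (Link.path link)) z∈) a~c a~z) no-wheel
      where
      link : Link b c x (p ∷ l)
      link = chord-link b~c b~x path (All.tail b∉) (b≁p ∷ ¬l)

    module _ (no-cutset : ¬ HasCliqueCutset G) where

      -- Diamonds and claws

      until-∈ : ∀ {P R : V → Set} {d xs} → Until P (λ w → w ≡ d × R w) xs → d ∈ xs
      until-∈ (end (refl , _)) = here refl
      until-∈ (_ ∷ u)          = there (until-∈ u)

      -- The first two vertices p and p₂ of a path from c to d avoiding K are complete to K (by fan),
      -- so K can be replaced by K ∪ {p}, and c, d by c, p₂.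
      clique-grows : ∀ K → Acc _⊃ₛ_ K → IsClique G K → ∀ {a b c d} → a ∈ₛ K → b ∈ₛ K → a ≢ b → Far c d →
                     (∀ {x} → x ∈ₛ K → x ~ c) → (∀ {x} → x ∈ₛ K → x ~ d) → ⊥
      clique-grows K (acc rec) clique {a} {b} {c} {d} a∈ b∈ a≢b c-d K~c K~d =
        extend L (proj₁ (proj₂ walk)) (proj₂ (proj₂ walk))
        where
        walk = route (connect (_∈? K) no-cutset clique (~-irrefl ∘ K~c) (~-irrefl ∘ K~d))
        L = proj₁ walk

        complete : ∀ {x c p L} → x ∈ₛ K → (∀ {x} → x ∈ₛ K → x ~ c) → IsPath (c ∷ p ∷ L) → d ∈ L →
                   All (λ w → ¬ w ∈ₛ K) (c ∷ p ∷ L) → x ~ p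
        -- `fan` needs a second node of `K` beside `x`: `b` when `x` is `a`, and `a` otherwise.
        complete {x} x∈ K~c path d∈ ∉K with x ≟ a
        ... | yes refl = fan (clique b a b∈ a∈ (a≢b ∘ sym)) (K~c b∈) (K~c a∈) (K~d b∈) (K~d a∈) path d∈
                           (All.map (λ w∉ → λ { refl → w∉ b∈ }) ∉K) (All.map (λ w∉ → λ { refl → w∉ a∈ }) ∉K)
        ... | no x≢a = fan (clique a x a∈ x∈ (x≢a ∘ sym)) (K~c a∈) (K~c x∈) (K~d a∈) (K~d x∈) path d∈
                           (All.map (λ w∉ → λ { refl → w∉ a∈ }) ∉K) (All.map (λ w∉ → λ { refl → w∉ x∈ }) ∉K)

        extend : ∀ L → IsPath (c ∷ L) → Until (λ w → ¬ w ∈ₛ K) (λ w → w ≡ d × ¬ w ∈ₛ K) (c ∷ L) → ⊥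
        extend [] path (end (c≡d , _)) = proj₁ c-d c≡d
        extend (p ∷ []) (cons c~p _ _) (_ ∷ end (refl , _)) = proj₂ c-d c~p
        extend (p ∷ p₂ ∷ L) path@(cons c~p (c-p₂ ∷ _) path′@(cons p~p₂ _ _)) (c∉ ∷ u@(p∉ ∷ u′)) =
          clique-grows (K ∪ ⁅ p ⁆) (rec (p⊆p∪q ⁅ p ⁆ , p , x∈p∪q⁺ (inj₂ (x∈⁅x⁆ p)) , p∉)) clique′
            (p⊆p∪q ⁅ p ⁆ a∈) (p⊆p∪q ⁅ p ⁆ b∈) a≢b c-p₂
            (λ x∈ → extended K~c (~-sym c~p) x∈) (λ x∈ → extended (λ x∈ → K~p₂ L path′ u′ x∈) p~p₂ x∈)
          where
          ∉K : ∀ {xs} → Until (λ w → ¬ w ∈ₛ K) (λ w → w ≡ d × ¬ w ∈ₛ K) xs → All (λ w → ¬ w ∈ₛ K) xs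
          ∉K (end q) = proj₂ q ∷ []
          ∉K (q ∷ u) = q ∷ ∉K u

          K~p : ∀ {x} → x ∈ₛ K → x ~ p
          K~p x∈ = complete x∈ K~c path (until-∈ u′) (c∉ ∷ ∉K u)

          K~p₂ : ∀ L → IsPath (p ∷ p₂ ∷ L) → Until (λ w → ¬ w ∈ₛ K) (λ w → w ≡ d × ¬ w ∈ₛ K) (p₂ ∷ L) →
                 ∀ {x} → x ∈ₛ K → x ~ p₂
          -- Either `p₂` is `d`, or the argument for `p` repeats with `p` in the place of `c`.
          K~p₂ []      _    (end (refl , _)) x∈ = K~d x∈
          K~p₂ (_ ∷ _) path (q ∷ u)          x∈ = complete x∈ K~p path (until-∈ u) (p∉ ∷ q ∷ ∉K u)

          extended : ∀ {z} → (∀ {x} → x ∈ₛ K → x ~ z) → p ~ z → ∀ {x} → x ∈ₛ K ∪ ⁅ p ⁆ → x ~ z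
          extended K~z p~z x∈ with x∈p∪q⁻ K ⁅ p ⁆ x∈
          ... | inj₁ x∈K = K~z x∈K
          ... | inj₂ x∈p with refl ← x∈⁅y⁆⇒x≡y p x∈p = p~z

          clique′ : IsClique G (K ∪ ⁅ p ⁆)
          clique′ u v u∈ v∈ u≢v with x∈p∪q⁻ K ⁅ p ⁆ u∈ | x∈p∪q⁻ K ⁅ p ⁆ v∈
          ... | inj₁ u∈K | inj₁ v∈K = clique u v u∈K v∈K u≢v
          ... | inj₁ u∈K | inj₂ v∈p with refl ← x∈⁅y⁆⇒x≡y p v∈p = K~p u∈K
          ... | inj₂ u∈p | inj₁ v∈K with refl ← x∈⁅y⁆⇒x≡y p u∈p = ~-sym (K~p v∈K)
          ... | inj₂ u∈p | inj₂ v∈p = contradiction (trans (x∈⁅y⁆⇒x≡y p u∈p) (sym (x∈⁅y⁆⇒x≡y p v∈p))) u≢v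

      diamond-free : ∀ {a b c d} → a ~ b → a ~ c → b ~ c → a ~ d → b ~ d → ¬ Far c d
      diamond-free {a} {b} a~b a~c b~c a~d b~d c-d =
        clique-grows (⁅ a ⁆ ∪ ⁅ b ⁆) (⊃-wellFounded _) clique
          (x∈p∪q⁺ (inj₁ (x∈⁅x⁆ a))) (x∈p∪q⁺ (inj₂ (x∈⁅x⁆ b))) (~⇒≢ a~b) c-d
          (λ x∈ → either a~c b~c x∈) (λ x∈ → either a~d b~d x∈)
        where
        either : ∀ {P : V → Set} → P a → P b → ∀ {x} → x ∈ₛ ⁅ a ⁆ ∪ ⁅ b ⁆ → P x
        either p q x∈ with x∈p∪q⁻ ⁅ a ⁆ ⁅ b ⁆ x∈
        ... | inj₁ x∈a with refl ← x∈⁅y⁆⇒x≡y a x∈a = p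
        ... | inj₂ x∈b with refl ← x∈⁅y⁆⇒x≡y b x∈b = q
        clique : IsClique G (⁅ a ⁆ ∪ ⁅ b ⁆)
        clique u v u∈ v∈ = either {λ u → u ≢ v → u ~ v}
          (either {λ v → a ≢ v → a ~ v} (contradiction refl) (λ _ → a~b) v∈)
          (either {λ v → b ≢ v → b ~ v} (λ _ → ~-sym a~b) (contradiction refl) v∈) u∈

      -- For adjacent `a` and `b` this is N[a] ∩ N[b]: the node `a` with the clique of N(a) that
      -- contains `b`.
      Side : V → V → V → Set
      Side a b x = x ≡ a ⊎ (a ~ x × ¬ Far b x)

      side? : ∀ a b x → Dec (Side a b x)
      side? a b x = x ≟ a ⊎-dec (a ~? x ×-dec ¬? (far? b x))

      -- Without diamonds, being equal or adjacent is transitive on N(a): nonadjacent `x`, `y` would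
      -- form a diamond with the edge `a`, `b`.
      close-clique : ∀ {a b x y} → a ~ b → a ~ x → a ~ y → ¬ Far b x → ¬ Far b y → x ≢ y → x ~ y
      close-clique {x = x} {y} a~b a~x a~y ¬bx ¬by x≢y with ¬far ¬bx | ¬far ¬by | x ~? y
      ... | _         | _         | yes x~y = x~y
      ... | inj₁ refl | inj₁ refl | no _    = contradiction refl x≢y
      ... | inj₁ refl | inj₂ b~y  | no _    = b~y
      ... | inj₂ b~x  | inj₁ refl | no _    = ~-sym b~x
      ... | inj₂ b~x  | inj₂ b~y  | no x≁y  =
        contradiction (x≢y , x≁y) (diamond-free a~b a~x b~x a~y b~y)

      side-clique : ∀ {a b} → a ~ b → ∀ u v → Side a b u → Side a b v → u ≢ v → u ~ v
      side-clique a~b u v (inj₁ refl)        (inj₁ refl)        u≢v = contradiction refl u≢v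
      side-clique a~b u v (inj₁ refl)        (inj₂ (a~v , _))   u≢v = a~v
      side-clique a~b u v (inj₂ (a~u , _))   (inj₁ refl)        u≢v = ~-sym a~u
      side-clique a~b u v (inj₂ (a~u , ¬bu)) (inj₂ (a~v , ¬bv)) u≢v = close-clique a~b a~u a~v ¬bu ¬bv u≢v

      -- The first walk is run backwards, since both walks leave from the same node `u`.
      walk-trans : ∀ {P Q u v} → P v → Walk P (_≡ v) u → Walk P Q u → Walk P Q v
      walk-trans pv (stop refl)    w = w
      walk-trans {P} {Q} {v = v} pv (step pu u~x x⇝v) w = walk-trans pv x⇝v (step (start x⇝v) (~-sym u~x) w)
        where
        start : ∀ {x} → Walk P (_≡ v) x → P x
        start (stop refl)   = pv
        start (step px _ _) = px

      until-zip : ∀ {P Q R xs} → Until P Q xs → All R xs → Until (λ x → P x × R x) (λ x → Q x × R x) xs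
      until-zip (end q) (r ∷ []) = end (q , r)
      until-zip (p ∷ u) (r ∷ rs) = (p , r) ∷ until-zip u rs

      -- If `a` sees nothing of `ws`, the paths through `ms`, `ws` and `a` form a theta with ends
      -- `b` and `y`. Otherwise the paths through `ms` and `ws` bound a hole, and `a` is a hub
      -- seeing `b`, `y` and a node of `ws`.
      two-paths : ∀ {a b y ws} {ms} → Link a b y ms → IsPath (b ∷ ws ++ [ y ]) → All (_≢ a) ws → Apart ms ws → ⊥
      two-paths {ws = []} link (cons b~y _ _) = contradiction b~y (proj₂ (Link.b-c link))
      two-paths {ms = []} link = contradiction refl (Link.nonempty link)
      two-paths {a} {b} {y} {w₀ ∷ ws} {m ∷ ms} link path₂@(cons b~w₀ b-ws path-ws) ws≢a ms-ws
        with any? (a ~?_) (w₀ ∷ ws) | Link.path link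
      ... | no none | path₁ = no-theta (theta (m ∷ ms) (w₀ ∷ ws) [ a ] (Link.b-c link) path₁ path₂
        (cons (~-sym a~b) (b-c ∷ []) (cons a~c [] single))
        ms-ws (All.map (λ f → far-sym f ∷ []) apart)
        (All.map (λ (w≢a , a≁w) → (w≢a , a≁w ∘ ~-sym) ∷ []) (All.zip (ws≢a , ¬Any⇒All¬ _ none))))
        where open Link link
      ... | yes hit | cons b~m b-ms path-ms with find hit
      ... | w , w∈ , a~w = no-wheel (wheel link′ a~b
          (subst (All (a ≢_)) (sym shape) (Allₚ.++⁺ (All.map proj₁ apart)
            (~⇒≢ a~c ∷ all-reverse (All.map (_∘ sym) ws≢a))))
          (subst (y ∈_) (sym shape) (Anyₚ.++⁺ʳ (m ∷ ms) (here refl)))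
          (subst (w ∈_) (sym shape) (Anyₚ.++⁺ʳ (m ∷ ms) (there (Anyₚ.reverse⁺ w∈))))
          (All.lookup (path-∉ path-yw) (Anyₚ.reverse⁺ w∈)) a~c a~w)
        where
        open Link link
        shape : (m ∷ (ms ++ y ∷ reverse ws)) ++ [ w₀ ] ≡ (m ∷ ms) ++ y ∷ reverse (w₀ ∷ ws)
        shape = trans (Listₚ.++-assoc (m ∷ ms) (y ∷ reverse ws) [ w₀ ])
                  (cong (λ z → (m ∷ ms) ++ y ∷ z) (sym (Listₚ.unfold-reverse w₀ ws)))
        path-yw : IsPath (y ∷ reverse (w₀ ∷ ws))
        path-yw = subst IsPath (Listₚ.reverse-++ (w₀ ∷ ws) [ y ]) (path-reverse path-ws)
        -- The hole is cut open at `b`, whose neighbours on it are `m` and `w₀`.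
        link′ : Link b m w₀ (ms ++ y ∷ reverse ws)
        link′ = record
          { a~b = b~m ; a~c = b~w₀ ; b-c = All.head (All.head ms-ws)
          ; path = subst IsPath (sym shape) (path-join (path-++ˡ m ms path-ms) path-yw
              (until-map (λ (f , g) → f ∷ all-reverse g) (λ (e , g) → e , all-reverse g)
                (until-zip (path-last m ms path-ms) ms-ws)))
          ; apart = Allₚ.++⁺ (Allₚ.++⁻ˡ ms b-ms)
              (All.head (Allₚ.++⁻ʳ ms b-ms) ∷ all-reverse (Allₚ.++⁻ˡ ws b-ws)) }

      -- If D is the component of G ∖ N[a] containing ms, then b and y are joined in G ∖ (D ∪ {a}),
      -- because N(D) meets at most two of the at least three components of N(a).
      module Claw {a b y d ms} (link : Link a b y ms) (a~d : a ~ d) (d-b : Far d b) (d-y : Far d y) where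

        open Link link renaming (a~c to a~y; b-c to b-y)

        -- Membership is a walk to `ms` and is never decided: only non-membership is carried along.
        D : V → Set
        D = Walk (Far a) (_∈ ms)

        Outside : V → Set
        Outside w = w ≢ a × ¬ D w

        neighbour∉D : ∀ {u} → a ~ u → ¬ D u
        neighbour∉D a~u (stop u∈)    = proj₂ (All.lookup apart u∈) a~u
        neighbour∉D a~u (step f _ _) = proj₂ f a~u

        outside : ∀ {u} → a ~ u → Outside u
        outside a~u = ~⇒≢ a~u ∘ sym , neighbour∉D a~u

        -- A node off D that is far from `a` has no neighbour in D, so D can be entered only from
        -- N(a). A neighbour of `a` on the walk is close to `p`, and then the walk jumps to `p`, or
        -- it is far from both `p` and `q`, and then `att` keeps the next node off D.
        avoid : ∀ {p q} → a ~ p → (∀ {u v} → a ~ u → Far p u → Far q u → u ~ v → ¬ D v) →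
                ∀ {u} → Walk (λ w → ¬ Side a q w) (λ w → w ≡ p × ¬ Side a q w) u → ¬ D u →
                Walk Outside (_≡ p) u
        avoid a~p att (stop (refl , _)) ¬Du = stop refl
        avoid {p} {q} a~p att {u} (step {v} u∉ u~v w) ¬Du with a ~? u | far? p u
        ... | yes a~u | no ¬f with ¬far ¬f
        ...   | inj₁ refl = stop refl
        ...   | inj₂ p~u  = step (outside a~u) (~-sym p~u) (stop refl)
        avoid {p} {q} a~p att {u} (step {v} u∉ u~v w) ¬Du | yes a~u | yes p-u =
          step (outside a~u) u~v (avoid a~p att w (att a~u p-u (decidable-stable (far? q u) λ ¬f → u∉ (inj₂ (a~u , ¬f))) u~v))
        avoid a~p att {u} (step u∉ u~v w) ¬Du | no a≁u | _ =
          step ((λ u≡a → u∉ (inj₁ u≡a)) , ¬Du) u~v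
            (avoid a~p att w λ Dv → ¬Du (step ((λ a≡u → u∉ (inj₁ (sym a≡u))) , a≁u) u~v Dv))

        around : Walk Outside (_≡ y) b
        -- Both walks start at the third leaf `d`, which lies outside D and outside both deleted
        -- cliques.
        around = walk-trans (outside a~b)
          (avoid a~b (λ a~u b-u y-u u~v → attached link (~-sym a~u) (far-sym b-u) (far-sym y-u) u~v)
            (connect (side? a y) no-cutset (side-clique a~y) (∉side a~d (far-sym d-y)) (∉side a~b (far-sym b-y))) (neighbour∉D a~d))
          (avoid a~y (λ a~u y-u b-u u~v → attached link (~-sym a~u) (far-sym b-u) (far-sym y-u) u~v)
            (connect (side? a b) no-cutset (side-clique a~b) (∉side a~d (far-sym d-b)) (∉side a~y b-y)) (neighbour∉D a~d))
          where
          ∉side : ∀ {p q} → a ~ p → Far q p → ¬ Side a q p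
          ∉side a~p _   (inj₁ refl)     = ~-irrefl a~p
          ∉side _   q-p (inj₂ (_ , ¬f)) = ¬f q-p

        -- A node `w` off D that sees `ms` must be adjacent to `a`. If it also sees `b` or `y`, it
        -- is the hub of a wheel; otherwise it is attached to D from a third clique.
        outside-apart : ∀ {ws} → IsPath (b ∷ ws ++ [ y ]) → All Outside ws → Apart ms ws
        outside-apart {ws} path₂ out = apart-sym (All.tabulate λ w∈ → All.tabulate λ m∈ → far w∈ m∈)
          where
          far : ∀ {w m} → w ∈ ws → m ∈ ms → Far w m
          far {w} {m} w∈ m∈ = (λ { refl → ¬Dw (stop m∈) }) , w≁m
            where
            ¬Dw = proj₂ (All.lookup out w∈)
            b≢w = All.lookup (path-∉ path₂) (Anyₚ.++⁺ˡ w∈)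
            y≢w = All.lookup (path-∉ (subst IsPath (Listₚ.reverse-++ (b ∷ ws) [ y ]) (path-reverse path₂)))
                    (Anyₚ.reverse⁺ {xs = b ∷ ws} (there w∈))
            w∉ : All (w ≢_) (b ∷ ms ++ [ y ])
            w∉ = (b≢w ∘ sym) ∷ Allₚ.++⁺ (All.tabulate λ { m∈ refl → ¬Dw (stop m∈) }) ((y≢w ∘ sym) ∷ [])
            m∈′ : m ∈ b ∷ ms ++ [ y ]
            m∈′ = there (Anyₚ.++⁺ˡ m∈)
            w≁m : ¬ w ~ m
            w≁m w~m with a ~? w | b ~? w | y ~? w
            ... | no a≁w  | _       | _ = ¬Dw (step (proj₁ (All.lookup out w∈) ∘ sym , a≁w) w~m (stop m∈))
            ... | yes a~w | yes b~w | _ = no-wheel (wheel link (~-sym a~w) w∉ (here refl) m∈′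
              (All.lookup (path-∉ path) (Anyₚ.++⁺ˡ m∈)) (~-sym b~w) w~m)
            ... | yes a~w | no _    | yes y~w = no-wheel (wheel link (~-sym a~w) w∉
              (there (Anyₚ.++⁺ʳ ms (here refl))) m∈′
              (All.lookup (path-∉ (subst IsPath (Listₚ.reverse-++ (b ∷ ms) [ y ]) (path-reverse path)))
                    (Anyₚ.reverse⁺ {xs = b ∷ ms} (there m∈))) (~-sym y~w) w~m)
            ... | yes a~w | no b≁w  | no y≁w =
              attached link (~-sym a~w) (b≢w ∘ sym , b≁w ∘ ~-sym) (y≢w ∘ sym , y≁w ∘ ~-sym) w~m (stop m∈)

        absurd : ⊥
        absurd = other (route around)
          where
          finish : ∀ {L} → IsPath (b ∷ L) → Until Outside (_≡ y) L → ⊥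
          finish path₂ u with until-snoc u
          ... | snoc out refl = two-paths link path₂ (All.map proj₁ out) (outside-apart path₂ out)
          other : (∃ λ L → IsPath (b ∷ L) × Until Outside (_≡ y) (b ∷ L)) → ⊥
          other ([] , _ , end b≡y)       = proj₁ b-y b≡y
          other (_ ∷ _ , path₂ , _ ∷ u) = finish path₂ u

      claw-free : ∀ {a b c d} → a ~ b → a ~ c → a ~ d → Far b c → Far b d → ¬ Far c d
      claw-free {a} {b} {c} {d} a~b a~c a~d b-c b-d c-d =
        go (proj₁ (proj₂ walk)) (untilK (proj₂ (proj₂ walk))) (a~L (proj₂ (proj₂ walk)))
        where
        -- Keeping `b` out of the deleted clique lets a path start at `b`; the first neighbour of
        -- `a` it meets then lies in another clique of N(a), and a hole through `a` closes there.
        K : V → Set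
        K x = Side a b x × x ≢ b

        walk = route (connect (λ x → side? a b x ×-dec ¬? (x ≟ b)) no-cutset
          (λ u v (p , _) (q , _) → side-clique a~b u v p q)
          {b} {c} (λ (_ , b≢b) → b≢b refl)
          λ { (inj₁ refl , _) → ~-irrefl a~c ; (inj₂ (_ , ¬f) , _) → ¬f b-c })

        untilK : ∀ {xs} → Until (¬_ ∘ K) (λ w → w ≡ c × ¬ K w) xs → All (¬_ ∘ K) xs
        untilK (end q) = proj₂ q ∷ []
        untilK (p ∷ u) = p ∷ untilK u

        a~L : ∀ {L} → Until (¬_ ∘ K) (λ w → w ≡ c × ¬ K w) (b ∷ L) → Any (a ~_) L
        a~L (end (b≡c , _)) = contradiction b≡c (proj₁ b-c)
        a~L (_ ∷ u)         = Any.map (λ { refl → a~c }) (until-∈ u)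

        -- The leaves `c` and `d` lie in different cliques of N(a), so one of them is far from `y`
        -- and serves as third leaf.
        third : ∀ {y ms} → Link a b y ms → ⊥
        third {y} link with far? c y | far? d y
        ... | yes c-y | _       = Claw.absurd link a~c (far-sym b-c) c-y
        ... | no _    | yes d-y = Claw.absurd link a~d (far-sym b-d) d-y
        ... | no ¬c   | no ¬d   = proj₂ c-d
          (close-clique (Link.a~c link) a~c a~d (¬c ∘ far-sym) (¬d ∘ far-sym) (proj₁ c-d))

        go : ∀ {L} → IsPath (b ∷ L) → All (¬_ ∘ K) (b ∷ L) → Any (a ~_) L → ⊥
        go path (_ ∷ ¬K) hit with firstHit (a ~?_) hit
        ... | first-hit {ms} {y} ¬ms a~y = third record
          { a~b = a~b ; a~c = a~y
          ; b-c = decidable-stable (far? b y) λ ¬f → All.head (Allₚ.++⁻ʳ ms ¬K)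
              (inj₂ (a~y , ¬f) , All.head (Allₚ.++⁻ʳ ms (path-∉ path)) ∘ sym)
          ; path = path-prefix (b ∷ ms) path
          ; apart = All.map (λ (¬Km , a≁m) → (λ { refl → ¬Km (inj₁ refl , ~⇒≢ a~b) }) , a≁m)
              (All.zip (Allₚ.++⁻ˡ ms ¬K , ¬ms)) }

      -- The root graph

      close-sym : ∀ {u v} → ¬ Far u v → ¬ Far v u
      close-sym ¬f = ¬f ∘ far-sym

      close-refl : ∀ {u} → ¬ Far u u
      close-refl (u≢u , _) = u≢u refl

      ~-close : ∀ {u v} → u ~ v → ¬ Far u v
      ~-close u~v (_ , u≁v) = u≁v u~v

      -- A node of the root graph is coded by a flag and a clique of G; only the node of degree one
      -- that stands for the missing second clique of v is flagged, and its clique is ⁅ v ⁆.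
      Code : Set
      Code = Subset (suc n)

      close? : ∀ u v x → Dec (¬ Far u x × ¬ Far v x)
      close? u v x = ¬? (far? u x) ×-dec ¬? (far? v x)

      -- For adjacent `u` and `v` this is the unique maximal clique containing both, as there are no
      -- diamonds.
      clique : V → V → Code
      clique u v = false ∷ comprehension (close? u v)

      infix 4 _∈ᶜ_

      _∈ᶜ_ : V → Code → Set
      x ∈ᶜ c = suc x ∈ₛ c

      ∈clique⁺ : ∀ {u v x} → ¬ Far u x → ¬ Far v x → x ∈ᶜ clique u v
      ∈clique⁺ {u} {v} p q = there (∈-comprehension⁺ (close? u v) (p , q))

      ∈clique⁻ : ∀ {u v x} → x ∈ᶜ clique u v → ¬ Far u x × ¬ Far v x
      ∈clique⁻ {u} {v} (there x∈) = ∈-comprehension⁻ (close? u v) x∈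

      code-⊆ : ∀ {u v u′ v′} → (∀ {x} → x ∈ᶜ clique u v → x ∈ᶜ clique u′ v′) → clique u v ⊆ₛ clique u′ v′
      code-⊆ f {suc x} x∈ = f x∈
      code-⊆ f {zero} ()

      clique-sym : ∀ u v → clique u v ≡ clique v u
      clique-sym u v = ⊆-antisym (code-⊆ {u} {v} {v} {u} (swap′ {u} {v})) (code-⊆ {v} {u} {u} {v} (swap′ {v} {u}))
        where
        swap′ : ∀ {u v x} → x ∈ᶜ clique u v → x ∈ᶜ clique v u
        swap′ {u} {v} x∈ with ∈clique⁻ {u} {v} x∈
        ... | p , q = ∈clique⁺ q p

      clique-cong : ∀ {v w x} → v ~ w → v ~ x → ¬ Far w x → clique v w ≡ clique v x
      clique-cong {v} {w} {x} v~w v~x w-x =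
        ⊆-antisym (code-⊆ {v} {w} {v} {x} (lemma v~w v~x w-x)) (code-⊆ {v} {x} {v} {w} (lemma v~x v~w (close-sym w-x)))
        where
        lemma : ∀ {w x y} → v ~ w → v ~ x → ¬ Far w x → y ∈ᶜ clique v w → y ∈ᶜ clique v x
        lemma {w} {x} {y} v~w v~x w-x y∈ with ∈clique⁻ {v} {w} y∈
        ... | v-y , w-y with ¬far v-y
        ... | inj₁ refl = ∈clique⁺ v-y (close-sym (~-close v~x))
        ... | inj₂ v~y  = ∈clique⁺ v-y λ x-y → proj₂ x-y (close-clique v~w v~x v~y w-x w-y (proj₁ x-y))

      record Sides (v : V) : Set where
        field
          side     : Bool → Code
          distinct : side true ≢ side false
          self     : ∀ s → v ∈ᶜ side s
          cover    : ∀ {x} → v ~ x → ∃ λ s → x ∈ᶜ side s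
          adjacent : ∀ s {x} → x ∈ᶜ side s → x ≢ v → v ~ x
          -- Any edge at `v` inside the clique determines its code, so adjacent nodes of `G` arrive
          -- at the same code.
          canon    : ∀ s {x} → x ∈ᶜ side s → x ≢ v → side s ≡ clique v x
          meet     : ∀ {x} → x ∈ᶜ side true → x ∈ᶜ side false → x ≡ v

      ∈clique⇒adj : ∀ {v w x} → x ∈ᶜ clique v w → x ≢ v → v ~ x
      ∈clique⇒adj {v} {w} x∈ x≢v with ¬far (proj₁ (∈clique⁻ {v} {w} x∈))
      ... | inj₁ refl = contradiction refl x≢v
      ... | inj₂ v~x  = v~x

      clique-canon : ∀ {v w x} → v ~ w → x ∈ᶜ clique v w → x ≢ v → clique v w ≡ clique v x
      clique-canon {v} {w} v~w x∈ x≢v =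
        clique-cong v~w (∈clique⇒adj {v} {w} x∈ x≢v) (proj₂ (∈clique⁻ {v} {w} x∈))

      self∈clique : ∀ {v w} → v ~ w → v ∈ᶜ clique v w
      self∈clique v~w = ∈clique⁺ close-refl (~-close (~-sym v~w))

      pendant : Bool → V → Code
      pendant s v = s ∷ ⁅ v ⁆

      ∈pendant : ∀ {s v x} → x ∈ᶜ pendant s v → x ≡ v
      ∈pendant {v = v} (there x∈) = x∈⁅y⁆⇒x≡y v x∈

      choose : {A : Set} → A → A → Bool → A
      choose x y true  = x
      choose x y false = y

      -- Since G has no claw and no diamond, N(v) is the union of at most two cliques.
      sides : ∀ v → Sides v
      sides v with ∃? (v ~?_)
      ... | no isolated = record
        -- Both ends of the edge for an isolated node carry the clique of `v` alone; only the flag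
        -- tells them apart.
        { side = λ s → pendant s v
        ; distinct = λ ()
        ; self = λ s → there (x∈⁅x⁆ v)
        ; cover = λ v~x → contradiction (_ , v~x) isolated
        ; adjacent = λ s x∈ x≢v → contradiction (∈pendant x∈) x≢v
        ; canon = λ s x∈ x≢v → contradiction (∈pendant x∈) x≢v
        ; meet = λ x∈ _ → ∈pendant x∈ }
      ... | yes (w , v~w) with ∃? (λ x → v ~? x ×-dec far? w x)
      ... | no none = record
        { side = choose (pendant true v) (clique v w)
        ; distinct = λ ()
        ; self = λ { true → there (x∈⁅x⁆ v) ; false → self∈clique v~w }
        ; cover = λ {x} v~x → false , ∈clique⁺ (~-close v~x) (λ w-x → none (x , v~x , w-x))
        ; adjacent = λ { true x∈ x≢v → contradiction (∈pendant x∈) x≢v ; false x∈ x≢v → ∈clique⇒adj {v} {w} x∈ x≢v }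
        ; canon = λ { true x∈ x≢v → contradiction (∈pendant x∈) x≢v ; false x∈ x≢v → clique-canon v~w x∈ x≢v }
        ; meet = λ x∈ _ → ∈pendant x∈ }
      ... | yes (x , v~x , w-x) = record
        { side = choose (clique v w) (clique v x)
        ; distinct = λ eq → ~⇒≢ v~w (sym (meet (w∈ w v~w) (subst (w ∈ᶜ_) eq (w∈ w v~w))))
        ; self = λ { true → self∈clique v~w ; false → self∈clique v~x }
        ; cover = cover
        ; adjacent = λ { true → ∈clique⇒adj {v} {w} ; false → ∈clique⇒adj {v} {x} }
        ; canon = λ { true → clique-canon v~w ; false → clique-canon v~x }
        ; meet = meet }
        where
        w∈ : ∀ w → v ~ w → w ∈ᶜ clique v w
        w∈ w v~w = ∈clique⁺ (~-close v~w) close-refl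
        meet : ∀ {y} → y ∈ᶜ clique v w → y ∈ᶜ clique v x → y ≡ v
        meet {y} y∈w y∈x with y ≟ v
        ... | yes y≡v = y≡v
        ... | no y≢v  = contradiction
          (close-clique (∈clique⇒adj {v} {w} y∈w y≢v) v~w v~x
            (close-sym (proj₂ (∈clique⁻ {v} {w} y∈w))) (close-sym (proj₂ (∈clique⁻ {v} {x} y∈x))) (proj₁ w-x))
          (proj₂ w-x)
        cover : ∀ {y} → v ~ y → ∃ λ s → y ∈ᶜ choose (clique v w) (clique v x) s
        cover {y} v~y with far? w y
        ... | no w-y  = true , ∈clique⁺ (~-close v~y) w-y
        ... | yes w-y = false , ∈clique⁺ (~-close v~y) (claw-free v~w v~x v~y w-x w-y)

      -- Nodes of `G` as edges of the root graph

      side : V → Bool → Code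
      side v = Sides.side (sides v)

      side-meet : ∀ {v x} s → x ∈ᶜ side v s → x ∈ᶜ side v (not s) → x ≡ v
      side-meet {v} true  p q = Sides.meet (sides v) p q
      side-meet {v} false p q = Sides.meet (sides v) q p

      -- The edge of the root graph that v stands for joins node v true and node v false.
      node : V → Bool → Fin (2 ^ suc n)
      node v s = encode (side v s)

      node-distinct : ∀ {v} s → node v s ≢ node v (not s)
      node-distinct {v} true  eq = Sides.distinct (sides v) (encode-injective eq)
      node-distinct {v} false eq = Sides.distinct (sides v) (sym (encode-injective eq))

      node-∈ : ∀ {u v} s t → node u s ≡ node v t → v ∈ᶜ side u s
      node-∈ {u} {v} s t eq = subst (v ∈ᶜ_) (sym (encode-injective eq)) (Sides.self (sides v) t)

      Ends : V → Fin (2 ^ suc n) → Fin (2 ^ suc n) → Set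
      Ends v p q = ∃ λ s → node v s ≡ p × node v (not s) ≡ q

      ends-sym : ∀ {v p q} → Ends v p q → Ends v q p
      ends-sym {v} (s , p , q) = not s , q , trans (cong (node v) (not-involutive s)) p

      ends? : ∀ v p q → Dec (Ends v p q)
      ends? v p q with node v true ≟ p ×-dec node v false ≟ q | node v false ≟ p ×-dec node v true ≟ q
      ... | yes e | _     = yes (true , e)
      ... | no _  | yes e = yes (false , e)
      ... | no ¬e | no ¬f = no λ { (true , e) → ¬e e ; (false , f) → ¬f f }

      edge? : ∀ p q → Dec (∃ λ v → Ends v p q)
      edge? p q = ∃? (λ v → ends? v p q)

      -- Codes that are no side of any node of `G` become isolated nodes, which lie on no edge and
      -- no cycle.
      root : Graph (2 ^ suc n)
      root = record
        { adj = λ p q → isYes (edge? p q)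
        ; sym = λ p q → isYes-⇔ (λ (v , e) → v , ends-sym e) (λ (v , e) → v , ends-sym e) (edge? p q) (edge? q p)
        ; loopless = λ p → isYes-no (λ { (v , s , refl , eq) → node-distinct {v} s (sym eq) }) (edge? p p) }

      root-edge : ∀ {p q} → Adj root p q → ∃ λ v → Ends v p q
      root-edge = toWitness

      edge-root : ∀ {v p q} → Ends v p q → Adj root p q
      edge-root {v} e = fromWitness (v , e)

      shared-adj : ∀ {u v} s t → node u s ≡ node v t → u ≢ v → u ~ v
      shared-adj {u} s t eq u≢v = Sides.adjacent (sides u) s (node-∈ s t eq) (u≢v ∘ sym)

      adj-shared : ∀ {u v} → u ~ v → ∃ λ s → ∃ λ t → node u s ≡ node v t
      adj-shared {u} {v} u~v =
        let s , v∈ = Sides.cover (sides u) u~v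
            t , u∈ = Sides.cover (sides v) (~-sym u~v)
        in s , t , cong encode (trans (Sides.canon (sides u) s v∈ (~⇒≢ u~v ∘ sym))
             (trans (clique-sym u v) (sym (Sides.canon (sides v) t u∈ (~⇒≢ u~v)))))

      -- No parallel edges: `v` would lie on both sides of `u`, and these meet only in `u`.
      ends-unique : ∀ {u v p q} → Ends u p q → Ends v p q → u ≡ v
      ends-unique {u} {v} (s , refl , refl) (t , eq , eq′) =
        sym (side-meet s (node-∈ s t (sym eq)) (node-∈ (not s) (not t) (sym eq′)))

      node-end : ∀ {v p q} → Ends v p q → ∀ s → node v s ≡ p ⊎ node v s ≡ q
      node-end (true  , p , q) true  = inj₁ p
      node-end (true  , p , q) false = inj₂ q
      node-end (false , p , q) true  = inj₂ q
      node-end (false , p , q) false = inj₁ p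

      shared-end : ∀ {u v p q p′ q′} → Ends u p q → Ends v p′ q′ → u ~ v →
                   p ≡ p′ ⊎ p ≡ q′ ⊎ q ≡ p′ ⊎ q ≡ q′
      shared-end e f u~v with adj-shared u~v
      ... | s , t , eq with node-end e s | node-end f t
      ... | inj₁ refl | inj₁ refl = inj₁ eq
      ... | inj₁ refl | inj₂ refl = inj₂ (inj₁ eq)
      ... | inj₂ refl | inj₁ refl = inj₂ (inj₂ (inj₁ eq))
      ... | inj₂ refl | inj₂ refl = inj₂ (inj₂ (inj₂ eq))

      orient : ∀ v → ∃ λ s → toℕ (node v s) < toℕ (node v (not s))
      orient v with ℕₚ.<-cmp (toℕ (node v true)) (toℕ (node v false))
      ... | tri< lt _ _ = true , lt
      ... | tri≈ _ eq _ = contradiction (toℕ-injective eq) (node-distinct {v} true)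
      ... | tri> _ _ gt = false , gt

      isLineGraph : IsLineGraphOf G root
      isLineGraph = edge , ordered , injective , surjective , λ i j → mk⇔ (to i j) (from i j)
        where
        edge : V → Fin (2 ^ suc n) × Fin (2 ^ suc n)
        edge v = let s , _ = orient v in node v s , node v (not s)

        ends : ∀ v → Ends v (proj₁ (edge v)) (proj₂ (edge v))
        ends v = proj₁ (orient v) , refl , refl

        ordered : ∀ v → let (p , q) = edge v in toℕ p < toℕ q × Adj root p q
        ordered v = proj₂ (orient v) , edge-root (ends v)

        injective : ∀ i j → edge i ≡ edge j → i ≡ j
        injective i j eq = ends-unique (ends i) (subst (λ (p , q) → Ends j p q) (sym eq) (ends j))

        surjective : ∀ p q → toℕ p < toℕ q → Adj root p q → Σ V λ i → edge i ≡ (p , q)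
        surjective p q p<q a with root-edge a
        ... | v , s , refl , refl = v , lemma (orient v) s p<q
          where
          lemma : (o : ∃ λ s → toℕ (node v s) < toℕ (node v (not s))) → ∀ s → toℕ (node v s) < toℕ (node v (not s)) →
                  (node v (proj₁ o) , node v (not (proj₁ o))) ≡ (node v s , node v (not s))
          lemma (true  , _) true  _  = refl
          lemma (false , _) false _  = refl
          lemma (true  , o) false lt = contradiction lt (ℕₚ.<-asym o)
          lemma (false , o) true  lt = contradiction lt (ℕₚ.<-asym o)

        ShareEnd : Fin (2 ^ suc n) × Fin (2 ^ suc n) → Fin (2 ^ suc n) × Fin (2 ^ suc n) → Set
        ShareEnd (p , q) (p′ , q′) = p ≡ p′ ⊎ p ≡ q′ ⊎ q ≡ p′ ⊎ q ≡ q′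

        to : ∀ i j → i ~ j → i ≢ j × ShareEnd (edge i) (edge j)
        to i j i~j = ~⇒≢ i~j , shared-end (ends i) (ends j) i~j

        from : ∀ i j → i ≢ j × ShareEnd (edge i) (edge j) → i ~ j
        from i j (i≢j , inj₁ eq)               = shared-adj _ _ eq i≢j
        from i j (i≢j , inj₂ (inj₁ eq))        = shared-adj _ _ eq i≢j
        from i j (i≢j , inj₂ (inj₂ (inj₁ eq))) = shared-adj _ _ eq i≢j
        from i j (i≢j , inj₂ (inj₂ (inj₂ eq))) = shared-adj _ _ eq i≢j

      -- Triangles and chords in the root graph

      root-irrefl : ∀ {p} → ¬ Adj root p p
      root-irrefl {p} = subst T (loopless root p)

      third-end : ∀ {v p q r} → Ends v p q → Adj root q r → Adj root p r → ∀ s → node v s ≢ r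
      third-end {p = p} {q} e qr pr s refl with node-end e s
      ... | inj₁ eq = root-irrefl (subst (Adj root p) eq pr)
      ... | inj₂ eq = root-irrefl (subst (Adj root q) eq qr)

      -- The edges of a triangle are pairwise adjacent nodes `x`, `y`, `z` of `G`. Being close to
      -- `x` and `y`, the node `z` lies in their common clique, the side of `x` at `q`; it also lies
      -- in the side at `p`, and the two sides meet only in `x`.
      triangleFree : TriangleFree root
      triangleFree p q r pq qr pr with root-edge pq | root-edge qr | root-edge pr
      ... | x , ex@(s , refl , refl) | y , (t , tq , tr) | z , (u , up , ur) with x ≟ y | x ≟ z
      ... | yes refl | _        = third-end ex qr pr (not t) tr
      ... | no _     | yes refl = third-end ex qr pr (not u) ur
      ... | no x≢y   | no x≢z   = x≢z (sym (side-meet s z∈p z∈q))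
        where
        open Sides using (canon; adjacent)
        y∈q : y ∈ᶜ side x (not s)
        y∈q = node-∈ (not s) t (sym tq)
        z∈p : z ∈ᶜ side x s
        z∈p = node-∈ s u (sym up)
        z∈r : z ∈ᶜ side y (not t)
        z∈r = node-∈ (not t) (not u) (trans tr (sym ur))
        z∈q : z ∈ᶜ side x (not s)
        z∈q with z ≟ y
        ... | yes refl = y∈q
        ... | no z≢y   = subst (z ∈ᶜ_) (sym (canon (sides x) (not s) y∈q (x≢y ∘ sym)))
          (∈clique⁺ (~-close (adjacent (sides x) s z∈p (x≢z ∘ sym)))
                    (~-close (adjacent (sides y) (not t) z∈r z≢y)))

      -- The edges of a cycle of the root graph form a hole of G, and a chord sees the four edges at its ends.
      module Chord (C : Cycle root) (i j : Fin (clen C)) (chord : Adj root (cv C i) (cv C j))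
                   (¬ij : prev j ≢ i) (¬ji : prev i ≢ j) where

        open Cycle C using () renaming (clen to k; clen≥3 to k≥3; cv to c; cinj to c-injective; cedges to c-edges)

        rim : Fin k → V
        rim x = proj₁ (root-edge (c-edges (prev x) x (prev-consecutive x)))

        rim-ends : ∀ x → Ends (rim x) (c (prev x)) (c x)
        rim-ends x = proj₂ (root-edge (c-edges (prev x) x (prev-consecutive x)))

        i≢j : i ≢ j
        i≢j refl = root-irrefl chord

        prev≢ : ∀ x → prev x ≢ x
        prev≢ x eq = root-irrefl (subst (λ y → Adj root (c y) (c x)) eq (c-edges (prev x) x (prev-consecutive x)))

        same-ends : ∀ {v p q p′ q′} → Ends v p q → Ends v p′ q′ → (p ≡ p′ × q ≡ q′) ⊎ (p ≡ q′ × q ≡ p′)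
        same-ends (true  , refl , refl) (true  , refl , refl) = inj₁ (refl , refl)
        same-ends (true  , refl , refl) (false , refl , refl) = inj₂ (refl , refl)
        same-ends (false , refl , refl) (true  , refl , refl) = inj₂ (refl , refl)
        same-ends (false , refl , refl) (false , refl , refl) = inj₁ (refl , refl)

        -- Equal edges traversed in opposite directions would close the cycle after two steps, but
        -- its length is at least three.
        rim-injective : ∀ x y → rim x ≡ rim y → x ≡ y
        rim-injective x y eq with same-ends (subst (λ v → Ends v (c (prev x)) (c x)) eq (rim-ends x)) (rim-ends y)
        ... | inj₁ (_ , cx≡cy) = c-injective x y cx≡cy
        ... | inj₂ (cpx≡cy , cx≡cpy) = contradiction
          (trans (cong prev (c-injective (prev x) y cpx≡cy)) (sym (c-injective x (prev y) cx≡cpy))) (prev-prev k≥3 x)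

        end-at : ∀ {v p q r} → Ends v p q → r ≡ p ⊎ r ≡ q → ∃ λ s → node v s ≡ r
        end-at (s , p , q) (inj₁ refl) = s , p
        end-at (s , p , q) (inj₂ refl) = not s , q

        share : ∀ {u v p q p′ q′ r} → Ends u p q → Ends v p′ q′ → r ≡ p ⊎ r ≡ q → r ≡ p′ ⊎ r ≡ q′ → u ≢ v → u ~ v
        share e f a b u≢v =
          let s , eq = end-at e a
              t , eq′ = end-at f b
          in shared-adj s t (trans eq (sym eq′)) u≢v

        rim-adjacent : ∀ x y → prev y ≡ x → rim x ~ rim y
        rim-adjacent x y refl = share (rim-ends (prev y)) (rim-ends y) (inj₂ refl) (inj₁ refl)
          (prev≢ y ∘ rim-injective (prev y) y)

        rim-consecutive : ∀ x y → rim x ~ rim y → CycConsec G k x y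
        rim-consecutive x y x~y = shared (shared-end (rim-ends x) (rim-ends y) x~y)
          where
          x≢y : x ≢ y
          x≢y refl = ~-irrefl x~y
          shared : c (prev x) ≡ c (prev y) ⊎ c (prev x) ≡ c y ⊎ c x ≡ c (prev y) ⊎ c x ≡ c y → CycConsec G k x y
          shared (inj₁ eq) = contradiction (prev-injective (c-injective (prev x) (prev y) eq)) x≢y
          shared (inj₂ (inj₁ eq)) =
            subst (CycConsec G k x) (c-injective (prev x) y eq) (consecutive-sym (prev-consecutive x))
          shared (inj₂ (inj₂ (inj₁ eq))) =
            subst (λ z → CycConsec G k z y) (sym (c-injective x (prev y) eq)) (prev-consecutive y)
          shared (inj₂ (inj₂ (inj₂ eq))) = contradiction (c-injective x y eq) x≢y

        triangle-chordless : (i j : Fin 3) → prev j ≢ i → prev i ≢ j → i ≡ j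
        triangle-chordless zero             zero             _  _  = refl
        triangle-chordless zero             (suc zero)       ne _  = contradiction refl ne
        triangle-chordless zero             (suc (suc zero)) _  ne = contradiction refl ne
        triangle-chordless (suc zero)       zero             _  ne = contradiction refl ne
        triangle-chordless (suc zero)       (suc zero)       _  _  = refl
        triangle-chordless (suc zero)       (suc (suc zero)) ne _  = contradiction refl ne
        triangle-chordless (suc (suc zero)) zero             ne _  = contradiction refl ne
        triangle-chordless (suc (suc zero)) (suc zero)       _  ne = contradiction refl ne
        triangle-chordless (suc (suc zero)) (suc (suc zero)) _  _  = refl

        -- On a cycle of length three any two distinct positions are consecutive.
        k≥4 : 4 ≤ k
        k≥4 = ℕₚ.≤∧≢⇒< k≥3 λ 3≡k → lemma 3≡k i j ¬ij ¬ji i≢j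
          where
          lemma : ∀ {k} → 3 ≡ k → (i j : Fin k) → prev j ≢ i → prev i ≢ j → i ≢ j → ⊥
          lemma refl i j p q i≢j = i≢j (triangle-chordless i j p q)

        hole : Hole G
        hole = record
          { size = k
          ; size≥4 = k≥4
          ; hv = rim
          ; hinj = rim-injective
          ; hinduced = λ x y → mk⇔ (rim-consecutive x y) (from x y) }
          where
          from : ∀ x y → CycConsec G k x y → rim x ~ rim y
          from x y xy with consecutive-prev x y xy
          ... | inj₁ eq = rim-adjacent x y eq
          ... | inj₂ eq = ~-sym (rim-adjacent y x eq)

        center : V
        center = proj₁ (root-edge chord)

        center-ends : Ends center (c i) (c j)
        center-ends = proj₂ (root-edge chord)

        center∉ : ∀ x → rim x ≢ center
        center∉ x eq with same-ends (subst (λ v → Ends v (c (prev x)) (c x)) eq (rim-ends x)) center-ends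
        ... | inj₁ (a , b) = ¬ij (trans (cong prev (sym (c-injective _ _ b))) (c-injective _ _ a))
        ... | inj₂ (a , b) = ¬ji (trans (cong prev (sym (c-injective _ _ b))) (c-injective _ _ a))

        chord-wheel : ContainsWheel G
        chord-wheel with prev-surjective i
        -- The spokes are the two cycle edges at `c i`, namely `rim i` and `rim i′` with `i′` the
        -- successor of `i`, and the edge `rim j` at `c j`; `i′` differs from `j` because `i` and
        -- `j` are not consecutive.
        ... | i′ , eq = hole , center , center∉ , i , j , i′ ,
          i≢j , (λ { refl → prev≢ i eq }) , (λ { refl → ¬ij eq }) ,
          share center-ends (rim-ends i) (inj₁ refl) (inj₂ refl) (center∉ i ∘ sym) ,
          share center-ends (rim-ends j) (inj₂ refl) (inj₂ refl) (center∉ j ∘ sym) ,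
          share center-ends (rim-ends i′) (inj₁ refl) (inj₁ (cong c (sym eq))) (center∉ i′ ∘ sym)

      chordless : Chordless root
      chordless C i j a with prev j ≟ i | prev i ≟ j
      ... | yes refl | _        = prev-consecutive j
      ... | no _     | yes refl = consecutive-sym (prev-consecutive i)
      ... | no ¬ij   | no ¬ji   = contradiction (Chord.chord-wheel C i j a ¬ij ¬ji) no-wheel

theorem2p5 : ∀ {n : ℕ} (G : Graph n) →
    ¬ ContainsTheta G → ¬ ContainsWheel G → ¬ ContainsPyramid G →
    (Σ ℕ λ m → Σ (Graph m) λ R → TriangleFree R × Chordless R × IsLineGraphOf G R)
    ⊎ HasCliqueCutset G
theorem2p5 G no-theta no-wheel no-pyramid with cliqueCutset? G
... | yes cutset   = inj₂ cutset
... | no no-cutset = inj₁ (_ , root G no-theta no-wheel no-pyramid no-cutset ,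
  triangleFree G no-theta no-wheel no-pyramid no-cutset ,
  chordless G no-theta no-wheel no-pyramid no-cutset ,
  isLineGraph G no-theta no-wheel no-pyramid no-cutset)
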